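{- As formal power series in $q$ (equivalently, for complex $q$ with $|q|<1$), $$\sum_{n\ge 0}\frac{q^{n^2+2n}}{(q;q)_{2n+1}}=\frac{1}{(q;q)_\infty}\sum_{k\in\mathbb{Z}}\left(q^{15k^2-7k}-q^{15k^2+13k+2}\right).$$
   Context: $(q;q)_n=\prod_{j=1}^{n}(1-q^j)$ and $(q;q)_\infty=\prod_{j\ge1}(1-q^j)$. -}

module Defs where

open import Data.Bool.Base using (if_then_else_)
open import Data.Fin.Base using (toℕ)
open import Data.Integer.Base as ℤ
  using (ℤ; +_; -[1+_]; 0ℤ; 1ℤ; _+_; _-_; _*_; _^_; ∣_∣)
import Data.Integer.Properties as ℤₚ
open import Data.Integer.Tactic.RingSolver using (solve-∀)
open import Data.List.Base using (List; _++_; foldr; map; upTo)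
open import Data.List.Membership.Propositional using (_∉_)
open import Data.List.Membership.Propositional.Properties
  using (∈-map⁺; ∈-map⁻; ∈-++⁺ˡ; ∈-++⁺ʳ; ∈-upTo⁺)
open import Data.List.Relation.Unary.Unique.Propositional using (Unique)
import Data.List.Relation.Unary.Unique.Propositional.Properties as Uniqueₚ
open import Data.Nat.Base as ℕ using (ℕ; zero; suc; _≡ᵇ_; _≤_; _<_; z≤n; s≤s)
import Data.Nat.Properties as ℕₚ
open import Data.Product.Base using (_,_)
open import Function.Base using (_∘_)
open import Relation.Binary.PropositionalEquality
open import Relation.Nullary.Negation using (¬_; contradiction)

open import Algebra.Properties.Semiring.Sum ℤₚ.+-*-semiring using (sum-syntax)

infix  4 _≈_
infixl 6 _⊖_
infixl 7 _⊛_ _÷_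
infix  8 q^_

-- Formal power series in q over ℤ: f n is the coefficient of qⁿ.

Series : Set
Series = ℕ → ℤ

_≈_ : Series → Series → Set
f ≈ g = ∀ n → f n ≡ g n

q^_ : ℕ → Series
(q^ n) m = if m ≡ᵇ n then 1ℤ else 0ℤ

𝟙 : Series
𝟙 = q^ 0

_⊖_ : Series → Series → Series
(f ⊖ g) n = f n - g n

_⊛_ : Series → Series → Series
(f ⊛ g) n = ∑[ i < suc n ] (f (toℕ i) * g (n ℕ.∸ toℕ i))

-- Long division, meaningful when f has constant term 1:
--   a / f = a₀ + q · ((a − a₀ f) / q) / f.
_÷_ : Series → Series → Series
(a ÷ f) zero    = a 0
(a ÷ f) (suc n) = ((λ m → a (suc m) - a 0 * f (suc m)) ÷ f) n

inv : Series → Series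
inv f = 𝟙 ÷ f

÷-⊛ : ∀ a f → f 0 ≡ 1ℤ → (a ÷ f) ⊛ f ≈ a
÷-⊛ a f f₀≡1 zero = begin
  a 0 * f 0 + 0ℤ  ≡⟨ ℤₚ.+-identityʳ _ ⟩
  a 0 * f 0       ≡⟨ cong (a 0 *_) f₀≡1 ⟩
  a 0 * 1ℤ        ≡⟨ ℤₚ.*-identityʳ _ ⟩
  a 0             ∎
  where open ≡-Reasoning
÷-⊛ a f f₀≡1 (suc n) =
  trans (cong (λ x → a 0 * f (suc n) + x) (÷-⊛ (λ m → a (suc m) - a 0 * f (suc m)) f f₀≡1 n))
        (cancel (a 0 * f (suc n)) (a (suc n)))
  where
  cancel : ∀ x y → x + (y - x) ≡ y
  cancel = solve-∀

inv-inverse : ∀ f → f 0 ≡ 1ℤ → inv f ⊛ f ≈ 𝟙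
inv-inverse = ÷-⊛ 𝟙

-- Limits of sequences of series: every coefficient is eventually constant.

record Convergent (f : ℕ → Series) : Set where
  field
    modulus : ℕ → ℕ
    stable  : ∀ m n → modulus m ≤ n → f n m ≡ f (modulus m) m

lim : (f : ℕ → Series) → Convergent f → Series
lim f c m = f (modulus m) m
  where open Convergent c

-- Sums of summable families: every power of q occurs in only finitely
-- many members. The sum does not depend on the choice of the supports.

record Summable {I : Set} (F : I → Series) : Set where
  field
    support  : ℕ → List I
    unique   : ∀ m → Unique (support m)
    vanishes : ∀ m i → i ∉ support m → F i m ≡ 0ℤ

Sum : {I : Set} (F : I → Series) → Summable F → Series
Sum F s m = foldr _+_ 0ℤ (map (λ i → F i m) (support m))
  where open Summable s

qPoch : ℕ → Series
qPoch zero    = 𝟙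
qPoch (suc n) = qPoch n ⊛ (𝟙 ⊖ q^ (suc n))

qPoch-0 : ∀ n → qPoch n 0 ≡ 1ℤ
qPoch-0 zero    = refl
qPoch-0 (suc n) = cong (λ x → x * 1ℤ + 0ℤ) (qPoch-0 n)

q^-below : ∀ {m n} → m < n → (q^ n) m ≡ 0ℤ
q^-below {zero}  (s≤s _) = refl
q^-below {suc m} (s≤s p) = q^-below p

q^⊛-below : ∀ {m n} g → m < n → (q^ n ⊛ g) m ≡ 0ℤ
q^⊛-below {zero}          g (s≤s _) = refl
q^⊛-below {suc m} {suc n} g (s≤s p) =
  trans (ℤₚ.+-identityˡ _) (q^⊛-below {m} {n} g p)

⊛-factor : ∀ f {m n} → m ≤ n → (f ⊛ (𝟙 ⊖ q^ (suc n))) m ≡ f m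
⊛-factor f {zero}      _ =
  trans (ℤₚ.+-identityʳ _) (ℤₚ.*-identityʳ (f 0))
⊛-factor f {suc m} {n} p = begin
  f 0 * (0ℤ - (q^ n) m) + rest  ≡⟨ cong (λ x → f 0 * (0ℤ - x) + rest) (q^-below p) ⟩
  f 0 * 0ℤ + rest               ≡⟨ cong (_+ rest) (ℤₚ.*-zeroʳ (f 0)) ⟩
  0ℤ + rest                     ≡⟨ ℤₚ.+-identityˡ rest ⟩
  rest                          ≡⟨ ⊛-factor (f ∘ suc) (ℕₚ.<⇒≤ p) ⟩
  f (suc m)                     ∎
  where
  open ≡-Reasoning
  rest = ((f ∘ suc) ⊛ (𝟙 ⊖ q^ (suc n))) m

qPoch-stable : ∀ m d → qPoch (d ℕ.+ m) m ≡ qPoch m m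
qPoch-stable m zero    = refl
qPoch-stable m (suc d) =
  trans (⊛-factor (qPoch (d ℕ.+ m)) (ℕₚ.m≤n+m m d)) (qPoch-stable m d)

qPoch-convergent : Convergent qPoch
qPoch-convergent = record
  { modulus = λ m → m
  ; stable  = λ m n m≤n →
      subst (λ k → qPoch k m ≡ qPoch m m) (ℕₚ.m∸n+n≡m m≤n)
            (qPoch-stable m (n ℕ.∸ m))
  }

qPoch∞ : Series
qPoch∞ = lim qPoch qPoch-convergent

lhsTerm : ℕ → Series
lhsTerm n = q^ (n ℕ.^ 2 ℕ.+ 2 ℕ.* n) ⊛ inv (qPoch (2 ℕ.* n ℕ.+ 1))

lhs-summable : Summable lhsTerm
lhs-summable = record
  { support  = λ m → upTo (suc m)
  ; unique   = λ m → Uniqueₚ.upTo⁺ (suc m)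
  ; vanishes = λ m n n∉ → q^⊛-below (inv (qPoch (2 ℕ.* n ℕ.+ 1)))
      (ℕₚ.<-≤-trans (ℕₚ.≰⇒> (λ n≤m → n∉ (∈-upTo⁺ (s≤s n≤m)))) (n≤exponent n))
  }
  where
  n≤exponent : ∀ n → n ≤ n ℕ.^ 2 ℕ.+ 2 ℕ.* n
  n≤exponent n = ℕₚ.≤-trans (ℕₚ.m≤m+n n (n ℕ.+ 0)) (ℕₚ.m≤n+m _ (n ℕ.^ 2))

e₁ e₂ : ℤ → ℤ
e₁ k = + 15 * k ^ 2 - + 7 * k
e₂ k = + 15 * k ^ 2 + + 13 * k + + 2

quad : ℕ → ℕ → ℕ → ℕ
quad b c p = suc p ℕ.+ (15 ℕ.* (p ℕ.* p) ℕ.+ b ℕ.* p ℕ.+ c)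

quad-pos : ∀ b c p →
  + quad b c p ≡ 1ℤ + + p + (+ 15 * (+ p * + p) + + b * + p + + c)
quad-pos b c p
  rewrite sym (ℤₚ.pos-* p p)
        | sym (ℤₚ.pos-* 15 (p ℕ.* p))
        | sym (ℤₚ.pos-* b p) = refl

e₁-pos : ∀ x → + 15 * ((1ℤ + x) * ((1ℤ + x) * 1ℤ)) - + 7 * (1ℤ + x)
                 ≡ 1ℤ + x + (+ 15 * (x * x) + + 22 * x + + 7)
e₁-pos = solve-∀

e₁-neg : ∀ x → + 15 * ((ℤ.- (1ℤ + x)) * ((ℤ.- (1ℤ + x)) * 1ℤ)) - + 7 * (ℤ.- (1ℤ + x))
                 ≡ 1ℤ + x + (+ 15 * (x * x) + + 36 * x + + 21)
e₁-neg = solve-∀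

e₂-pos : ∀ x → + 15 * ((1ℤ + x) * ((1ℤ + x) * 1ℤ)) + + 13 * (1ℤ + x) + + 2
                 ≡ 1ℤ + x + (+ 15 * (x * x) + + 42 * x + + 29)
e₂-pos = solve-∀

e₂-neg : ∀ x → + 15 * ((ℤ.- (1ℤ + x)) * ((ℤ.- (1ℤ + x)) * 1ℤ)) + + 13 * (ℤ.- (1ℤ + x)) + + 2
                 ≡ 1ℤ + x + (+ 15 * (x * x) + + 16 * x + + 3)
e₂-neg = solve-∀

e₁ℕ e₂ℕ : ℤ → ℕ
e₁ℕ (+ zero)  = 0
e₁ℕ (+ suc p) = quad 22 7 p
e₁ℕ -[1+ p ]  = quad 36 21 p
e₂ℕ (+ zero)  = 2
e₂ℕ (+ suc p) = quad 42 29 p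
e₂ℕ -[1+ p ]  = quad 16 3 p

e₁≡ : ∀ k → e₁ k ≡ + e₁ℕ k
e₁≡ (+ zero)  = refl
e₁≡ (+ suc p) = trans (e₁-pos (+ p)) (sym (quad-pos 22 7 p))
e₁≡ -[1+ p ]  = trans (e₁-neg (+ p)) (sym (quad-pos 36 21 p))

e₂≡ : ∀ k → e₂ k ≡ + e₂ℕ k
e₂≡ (+ zero)  = refl
e₂≡ (+ suc p) = trans (e₂-pos (+ p)) (sym (quad-pos 42 29 p))
e₂≡ -[1+ p ]  = trans (e₂-neg (+ p)) (sym (quad-pos 16 3 p))

∣k∣≤∣e₁∣ : ∀ k → ∣ k ∣ ≤ ∣ e₁ k ∣
∣k∣≤∣e₁∣ k = subst (λ e → ∣ k ∣ ≤ ∣ e ∣) (sym (e₁≡ k)) (bound k)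
  where
  bound : ∀ k → ∣ k ∣ ≤ e₁ℕ k
  bound (+ zero)  = z≤n
  bound (+ suc p) = ℕₚ.m≤m+n (suc p) _
  bound -[1+ p ]  = ℕₚ.m≤m+n (suc p) _

∣k∣≤∣e₂∣ : ∀ k → ∣ k ∣ ≤ ∣ e₂ k ∣
∣k∣≤∣e₂∣ k = subst (λ e → ∣ k ∣ ≤ ∣ e ∣) (sym (e₂≡ k)) (bound k)
  where
  bound : ∀ k → ∣ k ∣ ≤ e₂ℕ k
  bound (+ zero)  = z≤n
  bound (+ suc p) = ℕₚ.m≤m+n (suc p) _
  bound -[1+ p ]  = ℕₚ.m≤m+n (suc p) _

-- Both exponents are nonnegative, so ∣_∣ only changes their type.
e₁-nonneg : ∀ k → + ∣ e₁ k ∣ ≡ e₁ k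
e₁-nonneg k rewrite e₁≡ k = refl

e₂-nonneg : ∀ k → + ∣ e₂ k ∣ ≡ e₂ k
e₂-nonneg k rewrite e₂≡ k = refl

rhsTerm : ℤ → Series
rhsTerm k = q^ ∣ e₁ k ∣ ⊖ q^ ∣ e₂ k ∣

rhs-summable : Summable rhsTerm
rhs-summable = record
  { support  = λ m → map +_ (upTo (suc m)) ++ map -[1+_] (upTo (suc m))
  ; unique   = λ m → Uniqueₚ.++⁺
      (Uniqueₚ.map⁺ ℤₚ.+-injective (Uniqueₚ.upTo⁺ (suc m)))
      (Uniqueₚ.map⁺ ℤₚ.-[1+-injective (Uniqueₚ.upTo⁺ (suc m)))
      λ { (k∈ , k∈′) → disjoint (∈-map⁻ +_ k∈) (∈-map⁻ -[1+_] k∈′) }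
  ; vanishes = λ m k k∉ → let m<∣k∣ = ℕₚ.≰⇒> (outside m k k∉) in
      cong₂ _-_ (q^-below (ℕₚ.<-≤-trans m<∣k∣ (∣k∣≤∣e₁∣ k)))
                (q^-below (ℕₚ.<-≤-trans m<∣k∣ (∣k∣≤∣e₂∣ k)))
  }
  where
  open import Data.Product.Base using (∃; _×_)

  disjoint : ∀ {k} {A B : ℕ → Set} →
             ∃ (λ i → A i × k ≡ + i) → ¬ ∃ (λ j → B j × k ≡ -[1+ j ])
  disjoint (_ , _ , refl) (_ , _ , ())

  outside : ∀ m k → k ∉ map +_ (upTo (suc m)) ++ map -[1+_] (upTo (suc m)) →
            ¬ (∣ k ∣ ≤ m)
  outside m (+ n)    k∉ n≤m = k∉ (∈-++⁺ˡ (∈-map⁺ +_ (∈-upTo⁺ (s≤s n≤m))))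
  outside m -[1+ n ] k∉ n<m =
    k∉ (∈-++⁺ʳ (map +_ (upTo (suc m))) (∈-map⁺ -[1+_] (∈-upTo⁺ (ℕₚ.m≤n⇒m≤1+n n<m))))

{-# OPTIONS --safe #-}
module Submission where

-- This is a Bailey pair argument relative to a = q. Write vₙ = 1/(q;q)ₙ, with vₙ = 0 for n < 0.
-- Pascal's rule and the reflections k ↦ −k, k ↦ −1−k of the summation index give
--   Σₖ q^{6k²+4k} (v_{n−3k} v_{n+3k+1} − v_{n−3k−1} v_{n+3k+2}) = qⁿ v_{2n+1}.
-- Multiply by q^{n²+n}, sum over n and exchange the sums: the Durfee rectangle identity
--   Σₙ q^{n²+n} v_{n−r} v_{n+r+1} = q^{r²+r} / (q;q)_∞,
-- used at r = 3k and r = 3k+1, leaves the theta series. Coefficients up to q^M only depend on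
-- the series modulo q^{M+1}, where q is nilpotent and every sum is finite.

open import Data.Nat.Base as ℕ using (ℕ; zero; suc; z≤n; s≤s)
open import Data.Integer.Base as ℤ using (ℤ; +_; -[1+_]; 1ℤ; _+_; _-_; _*_; _^_; ∣_∣)
open import Defs

open import Algebra.Bundles using (CommutativeRing)
open import Data.Fin.Base using (toℕ)
open import Data.Fin.Properties using (toℕ<n)
import Data.Integer.Properties as ℤₚ
open import Data.Integer.Tactic.RingSolver using (solve-∀)
open import Data.List.Base using (List; []; _∷_; _++_; applyUpTo; foldr; map; upTo)
open import Data.List.Properties using (map-++; map-applyUpTo; map-upTo)
import Data.Nat.Properties as ℕₚ
import Data.Nat.Tactic.RingSolver as ℕ-Solver
open import Data.Product.Base using (∃; _,_; proj₁; proj₂)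
open import Function.Base using (_∘_)
open import Level using (0ℓ)
open import Relation.Binary.PropositionalEquality as ≡ using (_≡_)
import Relation.Binary.Reasoning.Setoid as ≋-Reasoning

-- Since u_a u_b = [a+b; a] v_{a+b}, the Bailey pair is a q-binomial identity, but Pascal's rule
-- does not close on it. Applied once, it changes the exponent 6k² + 4k into n + 6k² + k in one half
-- and, after a reflection, into n + 6k² + 5k + 1 in the other. What remains is qⁿ times an
-- auxiliary identity with value v_{2n}, and only that one is proved by induction, alternating
-- between even and odd upper index. For products of reciprocals Pascal's rule has the form x = c +
-- q^s x, with the unknown on both sides. Modulo q^{M+1} such an equation with s > 0 has exactly one
-- solution, and this replaces division by 1 - q^s. Identities keep the subtraction-free form X = Y
-- + t until the theta series is assembled. Truncation has a price: k runs over a finite window, so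
-- the reflection k ↦ -k needs n ≤ M, which makes the end terms vanish.

Nonneg : ℤ → Set
Nonneg i = ∃ λ n → i ≡ + n

quadℤ : ℕ → ℕ → ℕ → ℤ → ℤ
quadℤ a b c k = + a * (k * k) + + b * k + + c

quadℤ-pos : ∀ a b c p → quadℤ a b c (+ p) ≡ + (a ℕ.* (p ℕ.* p) ℕ.+ b ℕ.* p ℕ.+ c)
quadℤ-pos a b c p
  rewrite ≡.sym (ℤₚ.pos-* p p)
        | ≡.sym (ℤₚ.pos-* a (p ℕ.* p))
        | ≡.sym (ℤₚ.pos-* b p) = ≡.refl

-- A polynomial ak² + bk + c with 0 ≤ b ≤ a and c ≥ 0 is nonnegative at every integer k.
quadℤ-nonneg : ∀ b d c k → Nonneg (quadℤ (b ℕ.+ d) b c k)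
quadℤ-nonneg b d c (+ p)    = _ , quadℤ-pos (b ℕ.+ d) b c p
quadℤ-nonneg b d c -[1+ p ] = _ , (begin
  quadℤ (b ℕ.+ d) b c -[1+ p ]
    ≡⟨ reflect (+ b) (+ d) (+ c) (+ p) ⟩
  (+ b + + d) * (+ p * + p) + (+ b + + d + + d) * + p + (+ d + + c)
    ≡⟨ quadℤ-pos (b ℕ.+ d) (b ℕ.+ d ℕ.+ d) (d ℕ.+ c) p ⟩
  + _ ∎)
  where
  open ≡.≡-Reasoning
  reflect : ∀ b d c x →
    (b + d) * (ℤ.- (1ℤ + x) * (ℤ.- (1ℤ + x))) + b * (ℤ.- (1ℤ + x)) + c
      ≡ (b + d) * (x * x) + (b + d + d) * x + (d + c)
  reflect = solve-∀

-- A ring with elements Q n = qⁿ, v n = 1/(q;q)ₙ and q^{M+1} = 0.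
record QRing : Set₁ where
  field
    commutativeRing : CommutativeRing 0ℓ 0ℓ
  open CommutativeRing commutativeRing using (Carrier)
    renaming (_≈_ to _≋_; _+_ to _⊕_; _*_ to _⊗_; 0# to 0̂; 1# to 1̂)
  field
    M     : ℕ
    Q v   : ℕ → Carrier
    Q-0   : Q 0 ≋ 1̂
    Q-+   : ∀ m n → Q (m ℕ.+ n) ≋ Q m ⊗ Q n
    Q-vanish : ∀ {n} → M ℕ.< n → Q n ≋ 0̂
    v-0   : v 0 ≋ 1̂
    v-suc : ∀ n → v (suc n) ≋ v n ⊕ Q (suc n) ⊗ v (suc n)

module InQRing (S : QRing) where
  open QRing S
  open CommutativeRing commutativeRing hiding (_-_)
    renaming (_≈_ to _≋_; _+_ to _⊕_; _*_ to _⊗_; 0# to 0̂; 1# to 1̂)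
  open import Algebra.Properties.Semiring.Sum semiring
  open import Algebra.Properties.Group +-group using () renaming (∙-cancelʳ to ⊕-cancelʳ)
  open import Algebra.Solver.Ring.NaturalCoefficients.Default commutativeSemiring
    using (solve; _:+_; _:*_; _:=_)
  open ≋-Reasoning setoid

  -- Finite sums and bilateral sums over a window.

  N : ℕ
  N = suc M

  opaque
    Σ< : ℕ → (ℕ → Carrier) → Carrier
    Σ< n f = ∑[ i < n ] f (toℕ i)

    Σ<-empty : ∀ f → Σ< 0 f ≋ 0̂
    Σ<-empty f = refl

    Σ<-suc : ∀ n f → Σ< (suc n) f ≋ f 0 ⊕ Σ< n (f ∘ suc)
    Σ<-suc n f = refl

    Σ<-cong : ∀ n {f g} → (∀ i → f i ≋ g i) → Σ< n f ≋ Σ< n g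
    Σ<-cong n p = sum-cong-≋ {n} (λ i → p (toℕ i))

    Σ<-cong-< : ∀ n {f g} → (∀ i → i ℕ.< n → f i ≋ g i) → Σ< n f ≋ Σ< n g
    Σ<-cong-< n p = sum-cong-≋ {n} (λ i → p (toℕ i) (toℕ<n i))

    Σ<-zero : ∀ n {f} → (∀ i → i ℕ.< n → f i ≋ 0̂) → Σ< n f ≋ 0̂
    Σ<-zero n p = trans (sum-cong-≋ {n} (λ i → p (toℕ i) (toℕ<n i))) (sum-replicate-zero n)

    Σ<-+ : ∀ n f g → Σ< n (λ i → f i ⊕ g i) ≋ Σ< n f ⊕ Σ< n g
    Σ<-+ n f g = ∑-distrib-+ {n} (f ∘ toℕ) (g ∘ toℕ)

    Σ<-* : ∀ n x f → x ⊗ Σ< n f ≋ Σ< n (λ i → x ⊗ f i)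
    Σ<-* n x f = *-distribˡ-sum {n} x (f ∘ toℕ)

    Σ<-comm : ∀ m n (f : ℕ → ℕ → Carrier) → Σ< m (λ i → Σ< n (f i)) ≋ Σ< n (λ j → Σ< m (λ i → f i j))
    Σ<-comm m n f = ∑-comm {m} {n} (λ i j → f (toℕ i) (toℕ j))

  Σ<-split : ∀ m n f → Σ< (m ℕ.+ n) f ≋ Σ< m f ⊕ Σ< n (λ i → f (m ℕ.+ i))
  Σ<-split zero    n f = sym (trans (+-congʳ (Σ<-empty f)) (+-identityˡ _))
  Σ<-split (suc m) n f = begin
    Σ< (suc m ℕ.+ n) f
      ≈⟨ Σ<-suc _ f ⟩
    f 0 ⊕ Σ< (m ℕ.+ n) (f ∘ suc)
      ≈⟨ +-congˡ (Σ<-split m n (f ∘ suc)) ⟩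
    f 0 ⊕ (Σ< m (f ∘ suc) ⊕ Σ< n (λ i → f (suc m ℕ.+ i)))
      ≈⟨ +-assoc _ _ _ ⟨
    (f 0 ⊕ Σ< m (f ∘ suc)) ⊕ Σ< n (λ i → f (suc m ℕ.+ i))
      ≈⟨ +-congʳ (Σ<-suc m f) ⟨
    Σ< (suc m) f ⊕ Σ< n (λ i → f (suc m ℕ.+ i)) ∎

  Σ<-extend : ∀ m n f → (∀ i → m ℕ.≤ i → f i ≋ 0̂) → Σ< (m ℕ.+ n) f ≋ Σ< m f
  Σ<-extend m n f z = trans (Σ<-split m n f)
    (trans (+-congˡ (Σ<-zero n (λ i _ → z (m ℕ.+ i) (ℕₚ.m≤m+n m i)))) (+-identityʳ _))

  Σ<-last : ∀ n f → f n ≋ 0̂ → Σ< (suc n) f ≋ Σ< n f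
  Σ<-last n f fn≋0 = begin
    Σ< (suc n) f                         ≡⟨ ≡.cong (λ m → Σ< m f) (ℕₚ.+-comm 1 n) ⟩
    Σ< (n ℕ.+ 1) f                       ≈⟨ Σ<-split n 1 f ⟩
    Σ< n f ⊕ Σ< 1 (λ i → f (n ℕ.+ i))    ≈⟨ +-congˡ (Σ<-zero 1 last≋0) ⟩
    Σ< n f ⊕ 0̂                           ≈⟨ +-identityʳ _ ⟩
    Σ< n f                               ∎
    where
    last≋0 : ∀ i → i ℕ.< 1 → f (n ℕ.+ i) ≋ 0̂
    last≋0 zero    _         = trans (reflexive (≡.cong f (ℕₚ.+-identityʳ n))) fn≋0
    last≋0 (suc _) (s≤s ())

  opaque
    -- The window −N ≤ k < N is stable under k ↦ −1−k, but not under k ↦ −k.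
    Σℤ : (ℤ → Carrier) → Carrier
    Σℤ f = Σ< N (f ∘ +_) ⊕ Σ< N (f ∘ -[1+_])

    Σℤ-cong : ∀ {f g} → (∀ k → f k ≋ g k) → Σℤ f ≋ Σℤ g
    Σℤ-cong p = +-cong (Σ<-cong N (p ∘ +_)) (Σ<-cong N (p ∘ -[1+_]))

    Σℤ-+ : ∀ f g → Σℤ (λ k → f k ⊕ g k) ≋ Σℤ f ⊕ Σℤ g
    Σℤ-+ f g = trans (+-cong (Σ<-+ N _ _) (Σ<-+ N _ _))
      (solve 4 (λ a b c d → (a :+ b) :+ (c :+ d) := (a :+ c) :+ (b :+ d)) refl _ _ _ _)

    Σℤ-* : ∀ x f → Σℤ (λ k → x ⊗ f k) ≋ x ⊗ Σℤ f
    Σℤ-* x f = sym (trans (distribˡ _ _ _) (+-cong (Σ<-* N _ _) (Σ<-* N _ _)))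

    -- Negation carries -N ≤ k < N to -N < k ≤ N. The two windows differ only in the points -N and
    -- N, where the summand is assumed to vanish.
    Σℤ-neg : ∀ f → f (+ N) ≋ 0̂ → f (ℤ.- (+ N)) ≋ 0̂ → Σℤ f ≋ Σℤ (f ∘ ℤ.-_)
    Σℤ-neg f p n = begin
      Σ< N (f ∘ +_) ⊕ Σ< N (f ∘ -[1+_])
        ≈⟨ +-cong (Σ<-suc M (f ∘ +_)) (Σ<-last M (f ∘ -[1+_]) n) ⟩
      (f (+ 0) ⊕ P) ⊕ P′
        ≈⟨ solve 3 (λ a b c → (a :+ b) :+ c := (a :+ c) :+ b) refl _ _ _ ⟩
      (f (+ 0) ⊕ P′) ⊕ P
        ≈⟨ +-cong (Σ<-suc M (λ i → f (ℤ.- (+ i)))) (Σ<-last M (λ i → f (+ suc i)) p) ⟨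
      Σ< N (λ i → f (ℤ.- (+ i))) ⊕ Σ< N (λ i → f (+ suc i)) ∎
      where
      P P′ : Carrier
      P  = Σ< M (f ∘ +_ ∘ suc)
      P′ = Σ< M (f ∘ -[1+_])

    Σ<-Σℤ-comm : ∀ n (c : ℕ → Carrier) (g : ℤ → Carrier) (h : ℕ → ℤ → Carrier) →
      Σ< n (λ i → c i ⊗ Σℤ (λ k → g k ⊗ h i k)) ≋ Σℤ (λ k → g k ⊗ Σ< n (λ i → c i ⊗ h i k))
    Σ<-Σℤ-comm n c g h = begin
      Σ< n (λ i → c i ⊗ Σℤ (λ k → g k ⊗ h i k))
        ≈⟨ Σ<-cong n (λ i → distribˡ _ _ _) ⟩
      Σ< n (λ i → c i ⊗ Σ< N (λ j → g (+ j) ⊗ h i (+ j)) ⊕ c i ⊗ Σ< N (λ j → g -[1+ j ] ⊗ h i -[1+ j ]))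
        ≈⟨ Σ<-+ n _ _ ⟩
      _ ⊕ _
        ≈⟨ +-cong (half (λ j → + j)) (half -[1+_]) ⟩
      Σℤ (λ k → g k ⊗ Σ< n (λ i → c i ⊗ h i k)) ∎
      where
      half : (ι : ℕ → ℤ) → Σ< n (λ i → c i ⊗ Σ< N (λ j → g (ι j) ⊗ h i (ι j)))
                             ≋ Σ< N (λ j → g (ι j) ⊗ Σ< n (λ i → c i ⊗ h i (ι j)))
      half ι = begin
        Σ< n (λ i → c i ⊗ Σ< N (λ j → g (ι j) ⊗ h i (ι j)))
          ≈⟨ Σ<-cong n (λ i → Σ<-* N _ _) ⟩
        Σ< n (λ i → Σ< N (λ j → c i ⊗ (g (ι j) ⊗ h i (ι j))))
          ≈⟨ Σ<-comm n N _ ⟩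
        Σ< N (λ j → Σ< n (λ i → c i ⊗ (g (ι j) ⊗ h i (ι j))))
          ≈⟨ Σ<-cong N (λ j → Σ<-cong n (λ i → solve 3 (λ a b d → a :* (b :* d) := b :* (a :* d)) refl _ _ _)) ⟩
        Σ< N (λ j → Σ< n (λ i → g (ι j) ⊗ (c i ⊗ h i (ι j))))
          ≈⟨ Σ<-cong N (λ j → sym (Σ<-* n _ _)) ⟩
        Σ< N (λ j → g (ι j) ⊗ Σ< n (λ i → c i ⊗ h i (ι j))) ∎

    Σℤ-unfold : ∀ f → Σℤ f ≋ Σ< N (f ∘ +_) ⊕ Σ< N (f ∘ -[1+_])
    Σℤ-unfold f = refl

    Σℤ-reflect : ∀ {f g} → (∀ k → f -[1+ k ] ≋ g (+ k)) → (∀ k → f (+ k) ≋ g -[1+ k ]) → Σℤ f ≋ Σℤ g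
    Σℤ-reflect p q = trans (+-comm _ _) (+-cong (Σ<-cong N p) (Σ<-cong N q))

  -- Fixed-point equations and Pascal's rule.

  -- Substituting the equation into itself N times leaves a remainder q^{N(j+1)} x, which is 0
  -- because N(j+1) > M.
  fixpoint-unique : ∀ j {c x y} → x ≋ c ⊕ Q (suc j) ⊗ x → y ≋ c ⊕ Q (suc j) ⊗ y → x ≋ y
  fixpoint-unique j {c} p r = trans (to-c p) (sym (to-c r))
    where
    -- `c′` is chosen before the solution, so that the same value serves for `x` and for `y`.
    iterate : ∀ n → ∃ λ c′ → ∀ {x} → x ≋ c ⊕ Q (suc j) ⊗ x → x ≋ c′ ⊕ Q (n ℕ.* suc j) ⊗ x
    iterate zero = 0̂ , λ _ → sym (trans (+-identityˡ _) (trans (*-congʳ Q-0) (*-identityˡ _)))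
    iterate (suc n) with iterate n
    ... | c′ , h = c′ ⊕ Q (n ℕ.* suc j) ⊗ c , λ {x} p → begin
      x
        ≈⟨ h p ⟩
      c′ ⊕ Q (n ℕ.* suc j) ⊗ x
        ≈⟨ +-congˡ (*-congˡ p) ⟩
      c′ ⊕ Q (n ℕ.* suc j) ⊗ (c ⊕ Q (suc j) ⊗ x)
        ≈⟨ solve 5 (λ c′ a c b x → c′ :+ a :* (c :+ b :* x) := (c′ :+ a :* c) :+ (b :* a) :* x) refl _ _ _ _ _ ⟩
      (c′ ⊕ Q (n ℕ.* suc j) ⊗ c) ⊕ (Q (suc j) ⊗ Q (n ℕ.* suc j)) ⊗ x
        ≈⟨ +-congˡ (*-congʳ (Q-+ (suc j) (n ℕ.* suc j))) ⟨
      (c′ ⊕ Q (n ℕ.* suc j) ⊗ c) ⊕ Q (suc n ℕ.* suc j) ⊗ x ∎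
    to-c : ∀ {x} → x ≋ c ⊕ Q (suc j) ⊗ x → x ≋ proj₁ (iterate N)
    to-c p = trans (proj₂ (iterate N) p)
      (trans (+-congˡ (trans (*-congʳ (Q-vanish (ℕₚ.m≤m*n N (suc j)))) (zeroˡ _))) (+-identityʳ _))

  -- At a negative index pw is a junk value, which only occurs next to the factor u = 0.
  u pw : ℤ → Carrier
  u (+ n)     = v n
  u -[1+ n ]  = 0̂
  pw (+ n)    = Q n
  pw -[1+ n ] = 0̂

  -- Extension by 0 to negative indices preserves the recurrence; at i = 0 it degenerates to v₀ = 0
  -- + q⁰ v₀. Hence Pascal's rule holds at all integers and no summation range has to be tracked.
  u-step : ∀ i → u i ≋ u (i - + 1) ⊕ pw i ⊗ u i
  u-step (+ zero)  = sym (trans (+-identityˡ _) (trans (*-congʳ Q-0) (*-identityˡ _)))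
  u-step (+ suc n) = v-suc n
  u-step -[1+ n ]  = sym (trans (+-identityˡ _) (zeroˡ _))

  pw-u : ∀ {e} → Nonneg e → ∀ a → pw e ⊗ (pw a ⊗ u a) ≋ pw (e + a) ⊗ u a
  pw-u (n , ≡.refl) (+ m)    = trans (sym (*-assoc _ _ _)) (*-congʳ (sym (Q-+ n m)))
  pw-u (n , ≡.refl) -[1+ m ] = trans (*-congˡ (zeroʳ _)) (trans (zeroʳ _) (sym (zeroʳ _)))

  pw-+ : ∀ {i j} → Nonneg i → Nonneg j → pw (i + j) ≋ pw i ⊗ pw j
  pw-+ (m , ≡.refl) (n , ≡.refl) = Q-+ m n

  pw-u-u : ∀ a b → (pw a ⊗ u a) ⊗ (pw b ⊗ u b) ≋ pw (a + b) ⊗ (u a ⊗ u b)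
  pw-u-u (+ m) (+ n) = trans
    (solve 4 (λ a b c d → (a :* b) :* (c :* d) := (a :* c) :* (b :* d)) refl _ _ _ _)
    (*-congʳ (sym (Q-+ m n)))
  pw-u-u (+ m) -[1+ n ] = trans (*-congˡ (zeroʳ _)) (trans (zeroʳ _) (sym (trans (*-congˡ (zeroʳ _)) (zeroʳ _))))
  pw-u-u -[1+ m ] b     = trans (*-congʳ (zeroʳ _)) (trans (zeroˡ _) (sym (trans (*-congˡ (zeroˡ _)) (zeroʳ _))))

  term : ℤ → ℤ → ℤ → Carrier
  term e a b = pw e ⊗ (u a ⊗ u b)

  term-comm : ∀ e a b → term e a b ≋ term e b a
  term-comm e a b = *-congˡ (*-comm _ _)

  -- This is [a+b; a] = [a+b-1; a-1] + q^a [a+b-1; a] divided by the q-factorials. Expanding u_a and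
  -- then, only in the part q^a u_a, also u_b returns the original product with factor q^{a+b}. The
  -- rule is asymmetric: lowering b costs q^a, lowering a costs nothing.
  term-pascal : ∀ {e} → Nonneg e → ∀ a b →
    term e a b ≋ (term e (a - + 1) b ⊕ term (e + a) a (b - + 1)) ⊕ pw (a + b) ⊗ term e a b
  term-pascal {e} e≥0 a b = begin
    pw e ⊗ (u a ⊗ u b)
      ≈⟨ *-congˡ (*-congʳ (u-step a)) ⟩
    pw e ⊗ ((a′ ⊕ pa) ⊗ u b)
      ≈⟨ solve 4 (λ e a′ pa b → e :* ((a′ :+ pa) :* b) := e :* (a′ :* b) :+ (e :* pa) :* b) refl _ _ _ _ ⟩
    pw e ⊗ (a′ ⊗ u b) ⊕ (pw e ⊗ pa) ⊗ u b
      ≈⟨ +-congˡ (*-congˡ (u-step b)) ⟩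
    pw e ⊗ (a′ ⊗ u b) ⊕ (pw e ⊗ pa) ⊗ (b′ ⊕ pb)
      ≈⟨ solve 5 (λ x e pa b′ pb → x :+ (e :* pa) :* (b′ :+ pb) := (x :+ (e :* pa) :* b′) :+ e :* (pa :* pb)) refl _ _ _ _ _ ⟩
    (pw e ⊗ (a′ ⊗ u b) ⊕ (pw e ⊗ pa) ⊗ b′) ⊕ pw e ⊗ (pa ⊗ pb)
      ≈⟨ +-cong (+-congˡ (trans (*-congʳ (pw-u e≥0 a)) (*-assoc _ _ _))) (*-congˡ (pw-u-u a b)) ⟩
    (pw e ⊗ (a′ ⊗ u b) ⊕ pw (e + a) ⊗ (u a ⊗ b′)) ⊕ pw e ⊗ (pw (a + b) ⊗ (u a ⊗ u b))
      ≈⟨ +-congˡ (solve 3 (λ a b c → a :* (b :* c) := b :* (a :* c)) refl _ _ _) ⟩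
    (pw e ⊗ (a′ ⊗ u b) ⊕ pw (e + a) ⊗ (u a ⊗ b′)) ⊕ pw (a + b) ⊗ (pw e ⊗ (u a ⊗ u b)) ∎
    where
    a′ = u (a - + 1)
    b′ = u (b - + 1)
    pa = pw a ⊗ u a
    pb = pw b ⊗ u b

  -- The Durfee rectangle identity.

  v∞ : Carrier
  v∞ = v N

  v-stable : ∀ d → v (N ℕ.+ d) ≋ v∞
  v-stable zero    = reflexive (≡.cong v (ℕₚ.+-identityʳ N))
  v-stable (suc d) = begin
    v (N ℕ.+ suc d)
      ≡⟨ ≡.cong v (ℕₚ.+-suc N d) ⟩
    v (suc (N ℕ.+ d))
      ≈⟨ v-suc (N ℕ.+ d) ⟩
    v (N ℕ.+ d) ⊕ Q (suc (N ℕ.+ d)) ⊗ v (suc (N ℕ.+ d))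
      ≈⟨ +-cong (v-stable d) (trans (*-congʳ (Q-vanish (s≤s (ℕₚ.m≤n⇒m≤1+n (ℕₚ.m≤m+n M d))))) (zeroˡ _)) ⟩
    v∞ ⊕ 0̂
      ≈⟨ +-identityʳ _ ⟩
    v∞ ∎

  -- Generating function of the partitions whose Durfee rectangle is m × (m+c): the rectangle and
  -- the two partitions beside and below it. Summed over m, it should count all partitions, whatever
  -- c is.
  durfeeTerm : ℕ → ℕ → Carrier
  durfeeTerm c m = Q (m ℕ.* (m ℕ.+ c)) ⊗ (v m ⊗ v (m ℕ.+ c))

  durfeeSum : ℕ → Carrier
  durfeeSum c = Σ< N (durfeeTerm c)

  -- For c ≥ N every rectangle with m ≥ 1 has more than M cells, so only m = 0 survives.
  durfeeSum-large : ∀ d → durfeeSum (N ℕ.+ d) ≋ v∞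
  durfeeSum-large d = begin
    Σ< N (durfeeTerm (N ℕ.+ d))
      ≈⟨ Σ<-extend 1 M (durfeeTerm (N ℕ.+ d)) later ⟩
    Σ< 1 (durfeeTerm (N ℕ.+ d))
      ≈⟨ trans (Σ<-suc 0 _) (trans (+-congˡ (Σ<-empty _)) (+-identityʳ _)) ⟩
    Q 0 ⊗ (v 0 ⊗ v (N ℕ.+ d))
      ≈⟨ *-cong Q-0 (trans (*-cong v-0 (v-stable d)) (*-identityˡ _)) ⟩
    1̂ ⊗ v∞
      ≈⟨ *-identityˡ _ ⟩
    v∞ ∎
    where
    later : ∀ m → 1 ℕ.≤ m → durfeeTerm (N ℕ.+ d) m ≋ 0̂
    later (suc m) _ = trans (*-congʳ (Q-vanish (ℕₚ.≤-trans
        (ℕₚ.≤-trans (ℕₚ.m≤m+n N d) (ℕₚ.m≤n+m (N ℕ.+ d) (suc m)))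
        (ℕₚ.m≤m+n (suc m ℕ.+ (N ℕ.+ d)) (m ℕ.* (suc m ℕ.+ (N ℕ.+ d))))))) (zeroˡ _)

  -- Both sides equal Σ q^{m(m+c)} v_m v_{m+c+1}: use v_{m+c} + q^{m+c+1} v_{m+c+1} = v_{m+c+1}
  -- on the left and v_m = v_{m−1} + q^m v_m on the right.
  durfeeSum-step : ∀ c →
    durfeeSum c ⊕ Q (suc c) ⊗ durfeeSum (suc c) ≋ durfeeSum (suc c) ⊕ Q (suc c) ⊗ durfeeSum (suc (suc c))
  durfeeSum-step c = begin
    durfeeSum c ⊕ Q (suc c) ⊗ durfeeSum (suc c)
      ≈⟨ +-congˡ (Σ<-* N _ _) ⟩
    durfeeSum c ⊕ Σ< N (λ m → Q (suc c) ⊗ durfeeTerm (suc c) m)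
      ≈⟨ Σ<-+ N _ _ ⟨
    Σ< N (λ m → durfeeTerm c m ⊕ Q (suc c) ⊗ durfeeTerm (suc c) m)
      ≈⟨ Σ<-cong N left ⟩
    Σ< N common
      ≈⟨ Σ<-suc M common ⟩
    common 0 ⊕ Σ< M (common ∘ suc)
      ≈⟨ +-congˡ (Σ<-cong M right) ⟩
    durfeeTerm (suc c) 0 ⊕ Σ< M (λ m → durfeeTerm (suc c) (suc m) ⊕ Q (suc c) ⊗ durfeeTerm (2 ℕ.+ c) m)
      ≈⟨ +-congˡ (Σ<-+ M _ _) ⟩
    durfeeTerm (suc c) 0 ⊕ (Σ< M (durfeeTerm (suc c) ∘ suc) ⊕ Σ< M (λ m → Q (suc c) ⊗ durfeeTerm (2 ℕ.+ c) m))
      ≈⟨ +-assoc _ _ _ ⟨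
    (durfeeTerm (suc c) 0 ⊕ Σ< M (durfeeTerm (suc c) ∘ suc)) ⊕ Σ< M (λ m → Q (suc c) ⊗ durfeeTerm (2 ℕ.+ c) m)
      ≈⟨ +-cong (Σ<-suc M (durfeeTerm (suc c))) (Σ<-last M _ last) ⟨
    durfeeSum (suc c) ⊕ Σ< N (λ m → Q (suc c) ⊗ durfeeTerm (2 ℕ.+ c) m)
      ≈⟨ +-congˡ (Σ<-* N _ _) ⟨
    durfeeSum (suc c) ⊕ Q (suc c) ⊗ durfeeSum (2 ℕ.+ c) ∎
    where
    common : ℕ → Carrier
    common m = Q (m ℕ.* (m ℕ.+ c)) ⊗ (v m ⊗ v (m ℕ.+ suc c))

    e-left : ∀ m c → suc c ℕ.+ m ℕ.* (m ℕ.+ suc c) ≡ m ℕ.* (m ℕ.+ c) ℕ.+ suc (m ℕ.+ c)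
    e-left = ℕ-Solver.solve-∀

    e-mid : ∀ m c → suc m ℕ.* (suc m ℕ.+ suc c) ≡ suc m ℕ.* (suc m ℕ.+ c) ℕ.+ suc m
    e-mid = ℕ-Solver.solve-∀

    e-right : ∀ m c → suc m ℕ.* (suc m ℕ.+ c) ≡ suc c ℕ.+ m ℕ.* (m ℕ.+ suc (suc c))
    e-right = ℕ-Solver.solve-∀

    left : ∀ m → durfeeTerm c m ⊕ Q (suc c) ⊗ durfeeTerm (suc c) m ≋ common m
    left m = begin
      x ⊗ (v m ⊗ v (m ℕ.+ c)) ⊕ Q (suc c) ⊗ (Q (m ℕ.* (m ℕ.+ suc c)) ⊗ (v m ⊗ v (m ℕ.+ suc c)))
        ≈⟨ +-congˡ (trans (sym (*-assoc _ _ _)) (*-cong (sym (Q-+ _ _)) (*-congˡ (reflexive (≡.cong v (ℕₚ.+-suc m c)))))) ⟩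
      x ⊗ (v m ⊗ v (m ℕ.+ c)) ⊕ Q (suc c ℕ.+ m ℕ.* (m ℕ.+ suc c)) ⊗ (v m ⊗ y)
        ≈⟨ +-congˡ (*-congʳ (trans (reflexive (≡.cong Q (e-left m c))) (Q-+ _ _))) ⟩
      x ⊗ (v m ⊗ v (m ℕ.+ c)) ⊕ (x ⊗ Q (suc (m ℕ.+ c))) ⊗ (v m ⊗ y)
        ≈⟨ solve 5 (λ x a b p y → x :* (a :* b) :+ (x :* p) :* (a :* y) := x :* (a :* (b :+ p :* y))) refl _ _ _ _ _ ⟩
      x ⊗ (v m ⊗ (v (m ℕ.+ c) ⊕ Q (suc (m ℕ.+ c)) ⊗ y))
        ≈⟨ *-congˡ (*-congˡ (trans (sym (v-suc (m ℕ.+ c))) (reflexive (≡.cong v (≡.sym (ℕₚ.+-suc m c)))))) ⟩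
      common m ∎
      where
      x = Q (m ℕ.* (m ℕ.+ c))
      y = v (suc (m ℕ.+ c))

    right : ∀ m → common (suc m) ≋ durfeeTerm (suc c) (suc m) ⊕ Q (suc c) ⊗ durfeeTerm (2 ℕ.+ c) m
    right m = begin
      x ⊗ (v (suc m) ⊗ y)
        ≈⟨ *-congˡ (*-congʳ (v-suc m)) ⟩
      x ⊗ ((v m ⊕ Q (suc m) ⊗ v (suc m)) ⊗ y)
        ≈⟨ solve 5 (λ x a p b y → x :* ((a :+ p :* b) :* y) := (x :* p) :* (b :* y) :+ x :* (a :* y)) refl _ _ _ _ _ ⟩
      (x ⊗ Q (suc m)) ⊗ (v (suc m) ⊗ y) ⊕ x ⊗ (v m ⊗ y)
        ≈⟨ +-cong (*-congʳ (trans (sym (Q-+ _ _)) (reflexive (≡.cong Q (≡.sym (e-mid m c))))))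
                  (*-cong (trans (reflexive (≡.cong Q (e-right m c))) (Q-+ _ _))
                          (*-congˡ (reflexive (≡.cong v (≡.sym (ℕₚ.+-suc m (suc c))))))) ⟩
      durfeeTerm (suc c) (suc m) ⊕ (Q (suc c) ⊗ Q (m ℕ.* (m ℕ.+ (2 ℕ.+ c)))) ⊗ (v m ⊗ v (m ℕ.+ (2 ℕ.+ c)))
        ≈⟨ +-congˡ (*-assoc _ _ _) ⟩
      durfeeTerm (suc c) (suc m) ⊕ Q (suc c) ⊗ durfeeTerm (2 ℕ.+ c) m ∎
      where
      x = Q (suc m ℕ.* (suc m ℕ.+ c))
      y = v (suc m ℕ.+ suc c)

    -- Splitting off m = 0 shifted the index and left only M terms. The N-th one may be added
    -- because its exponent (c+1) + M(M+c+2) = N(N+c) exceeds M.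
    last : Q (suc c) ⊗ durfeeTerm (2 ℕ.+ c) M ≋ 0̂
    last = begin
      Q (suc c) ⊗ (Q (M ℕ.* (M ℕ.+ (2 ℕ.+ c))) ⊗ _)
        ≈⟨ *-assoc _ _ _ ⟨
      (Q (suc c) ⊗ Q (M ℕ.* (M ℕ.+ (2 ℕ.+ c)))) ⊗ _
        ≈⟨ *-congʳ (trans (sym (Q-+ _ _)) (reflexive (≡.cong Q (≡.sym (e-right M c))))) ⟩
      Q (suc M ℕ.* (suc M ℕ.+ c)) ⊗ _
        ≈⟨ *-congʳ (Q-vanish (ℕₚ.≤-trans (ℕₚ.m≤m+n N c) (ℕₚ.m≤m+n (N ℕ.+ c) (M ℕ.* (N ℕ.+ c))))) ⟩
      0̂ ⊗ _
        ≈⟨ zeroˡ _ ⟩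
      0̂ ∎

  -- Descending induction on c, starting from c ≥ N: once the sums at c+1 and c+2 equal v∞,
  -- `durfeeSum-step` gives the one at c after cancelling q^{c+1} v∞.
  durfee : ∀ c → durfeeSum c ≋ v∞
  durfee c = descend N c c ≡.refl
    where
    -- The slack `e` lets c overshoot N, so that c+1 and c+2 are both reached with the same smaller
    -- `d`.
    descend : ∀ d e c → d ℕ.+ c ≡ N ℕ.+ e → durfeeSum c ≋ v∞
    descend zero    e c ≡.refl = durfeeSum-large e
    descend (suc d) e c eq     = ⊕-cancelʳ (Q (suc c) ⊗ v∞) _ _ (begin
      durfeeSum c ⊕ Q (suc c) ⊗ v∞
        ≈⟨ +-congˡ (*-congˡ next) ⟨
      durfeeSum c ⊕ Q (suc c) ⊗ durfeeSum (suc c)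
        ≈⟨ durfeeSum-step c ⟩
      durfeeSum (suc c) ⊕ Q (suc c) ⊗ durfeeSum (suc (suc c))
        ≈⟨ +-cong next (*-congˡ (descend d (suc e) (suc (suc c))
             (≡.trans (ℕₚ.+-suc d (suc c)) (≡.trans (≡.cong suc (≡.trans (ℕₚ.+-suc d c) eq)) (≡.sym (ℕₚ.+-suc N e)))))) ⟩
      v∞ ⊕ Q (suc c) ⊗ v∞ ∎)
      where
      next : durfeeSum (suc c) ≋ v∞
      next = descend d e (suc c) (≡.trans (ℕₚ.+-suc d c) eq)

  -- For r ≥ 0 the terms with n < r vanish, and n = r + m gives n² + n = (r² + r) + m(m + 2r + 1),
  -- which is the Durfee sum at c = 2r + 1. Negative r reduces to this case, as r ↦ -1-r exchanges
  -- the two indices and fixes r² + r.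
  durfee-shifted : ∀ r → Σ< N (λ n → Q (n ℕ.* n ℕ.+ n) ⊗ (u (+ n - r) ⊗ u (+ n + r + + 1)))
                           ≋ pw (r * r + r) ⊗ v∞
  durfee-shifted (+ r) = begin
    Σ< N F
      -- The r extra terms have exponent n² + n ≥ N; adding them leaves a full range of N values for
      -- m after the shift.
      ≈⟨ Σ<-extend N r F (λ i N≤i → trans (*-congʳ (Q-vanish (ℕₚ.≤-trans N≤i (ℕₚ.m≤n+m i (i ℕ.* i))))) (zeroˡ _)) ⟨
    Σ< (N ℕ.+ r) F
      ≡⟨ ≡.cong (λ n → Σ< n F) (ℕₚ.+-comm N r) ⟩
    Σ< (r ℕ.+ N) F
      ≈⟨ Σ<-split r N F ⟩
    Σ< r F ⊕ Σ< N (λ m → F (r ℕ.+ m))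
      ≈⟨ +-cong (Σ<-zero r early) (Σ<-cong N late) ⟩
    0̂ ⊕ Σ< N (λ m → Q (r ℕ.* r ℕ.+ r) ⊗ durfeeTerm (suc (r ℕ.+ r)) m)
      ≈⟨ trans (+-identityˡ _) (sym (Σ<-* N _ _)) ⟩
    Q (r ℕ.* r ℕ.+ r) ⊗ durfeeSum (suc (r ℕ.+ r))
      ≈⟨ *-cong (reflexive (≡.cong (λ i → pw (i + + r)) (ℤₚ.pos-* r r))) (durfee _) ⟩
    pw (+ r * + r + + r) ⊗ v∞ ∎
    where
    F : ℕ → Carrier
    F n = Q (n ℕ.* n ℕ.+ n) ⊗ (u (+ n - + r) ⊗ u (+ n + + r + + 1))

    early : ∀ i → i ℕ.< r → F i ≋ 0̂
    early i i<r with ℕₚ.m≤n⇒∃[o]m+o≡n i<r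
    ... | d , ≡.refl = trans (*-congˡ (trans (*-congʳ (reflexive (≡.cong u (diff (+ i) (+ d))))) (zeroˡ _))) (zeroʳ _)
      where
      diff : ∀ x y → x - (1ℤ + (x + y)) ≡ ℤ.- (1ℤ + y)
      diff = solve-∀

    exponent : ∀ r m → (r ℕ.+ m) ℕ.* (r ℕ.+ m) ℕ.+ (r ℕ.+ m) ≡ (r ℕ.* r ℕ.+ r) ℕ.+ m ℕ.* (m ℕ.+ suc (r ℕ.+ r))
    exponent = ℕ-Solver.solve-∀
    arg₁ : ∀ x y → x + y - x ≡ y
    arg₁ = solve-∀
    arg₂ : ∀ x y → x + y + x + + 1 ≡ y + (1ℤ + (x + x))
    arg₂ = solve-∀

    late : ∀ m → F (r ℕ.+ m) ≋ Q (r ℕ.* r ℕ.+ r) ⊗ durfeeTerm (suc (r ℕ.+ r)) m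
    late m = trans
      (*-cong (trans (reflexive (≡.cong Q (exponent r m))) (Q-+ _ _))
              (*-cong (reflexive (≡.cong u (arg₁ (+ r) (+ m)))) (reflexive (≡.cong u (arg₂ (+ r) (+ m))))))
      (*-assoc _ _ _)
  durfee-shifted -[1+ r ] = begin
    Σ< N (λ n → Q (n ℕ.* n ℕ.+ n) ⊗ (u (+ n - -[1+ r ]) ⊗ u (+ n + -[1+ r ] + + 1)))
      ≈⟨ Σ<-cong N (λ n → *-congˡ (trans (*-comm _ _)
           (*-cong (reflexive (≡.cong u (arg₁ (+ n) (+ r)))) (reflexive (≡.cong u (arg₂ (+ n) (+ r))))))) ⟩
    Σ< N (λ n → Q (n ℕ.* n ℕ.+ n) ⊗ (u (+ n - + r) ⊗ u (+ n + + r + + 1)))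
      ≈⟨ durfee-shifted (+ r) ⟩
    pw (+ r * + r + + r) ⊗ v∞
      ≡⟨ ≡.cong (λ i → pw i ⊗ v∞) (exponent (+ r)) ⟩
    pw (-[1+ r ] * -[1+ r ] + -[1+ r ]) ⊗ v∞ ∎
    where
    exponent : ∀ x → x * x + x ≡ ℤ.- (1ℤ + x) * ℤ.- (1ℤ + x) + ℤ.- (1ℤ + x)
    exponent = solve-∀
    arg₁ : ∀ n x → n + ℤ.- (1ℤ + x) + + 1 ≡ n - x
    arg₁ = solve-∀
    arg₂ : ∀ n x → n - ℤ.- (1ℤ + x) ≡ n + x + + 1
    arg₂ = solve-∀

  -- Pascal's rule and reflections for bilateral sums.

  opaque
    W : (e a b : ℤ → ℤ) → Carrier
    W e a b = Σℤ (λ k → term (e k) (a k) (b k))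

    W-swap : ∀ {e a b a′ b′} → (∀ k → a k ≡ b′ k) → (∀ k → b k ≡ a′ k) → W e a b ≋ W e a′ b′
    W-swap {e} {a} {b} a≡b′ b≡a′ = Σℤ-cong (λ k → trans (term-comm (e k) (a k) (b k))
      (reflexive (≡.cong₂ (term (e k)) (b≡a′ k) (a≡b′ k))))

    W-factor : ∀ L {e} → (∀ k → Nonneg (e k)) → ∀ a b →
      W (λ k → + L + e k) a b ≋ Q L ⊗ W e a b
    W-factor L {e} e≥0 a b = trans
      (Σℤ-cong (λ k → trans (*-congʳ (pw-+ {+ L} {e k} (L , ≡.refl) (e≥0 k))) (*-assoc _ _ _)))
      (Σℤ-* (Q L) (λ k → term (e k) (a k) (b k)))

    -- Because a + b does not depend on k, the factor q^{a+b} leaves the sum, and the whole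
    -- bilateral sum satisfies one equation x = c + q^s x.
    W-pascal : ∀ {e} → (∀ k → Nonneg (e k)) → ∀ a b {a′ e′ b′ s} →
      (∀ k → a k - + 1 ≡ a′ k) → (∀ k → e k + a k ≡ e′ k) →
      (∀ k → b k - + 1 ≡ b′ k) → (∀ k → a k + b k ≡ s) →
      W e a b ≋ (W e a′ b ⊕ W e′ a b′) ⊕ pw s ⊗ W e a b
    W-pascal {e} e≥0 a b {a′} {e′} {b′} {s} a-1≡a′ e+a≡e′ b-1≡b′ a+b≡s = begin
      W e a b
        ≈⟨ Σℤ-cong (λ k → trans (term-pascal (e≥0 k) (a k) (b k))
             (+-cong (+-cong (reflexive (≡.cong (λ i → term (e k) i (b k)) (a-1≡a′ k)))
                             (reflexive (≡.cong₂ (λ i j → term i (a k) j) (e+a≡e′ k) (b-1≡b′ k))))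
                     (reflexive (≡.cong (λ i → pw i ⊗ term (e k) (a k) (b k)) (a+b≡s k))))) ⟩
      Σℤ (λ k → (term (e k) (a′ k) (b k) ⊕ term (e′ k) (a k) (b′ k)) ⊕ pw s ⊗ term (e k) (a k) (b k))
        ≈⟨ trans (Σℤ-+ _ _) (+-cong (Σℤ-+ _ _) (Σℤ-* _ _)) ⟩
      (W e a′ b ⊕ W e′ a b′) ⊕ pw s ⊗ W e a b ∎

    W-reflect : ∀ {e a b e′ a′ b′} →
      (∀ k → e (ℤ.- (1ℤ + k)) ≡ e′ k) → (∀ k → a (ℤ.- (1ℤ + k)) ≡ b′ k) → (∀ k → b (ℤ.- (1ℤ + k)) ≡ a′ k) →
      W e a b ≋ W e′ a′ b′
    W-reflect {e} {a} {b} {e′} {a′} {b′} e≡ a≡ b≡ = Σℤ-reflect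
      (λ k → swapped (+ k))
      (λ k → trans (reflexive (≡.cong (λ i → term (e i) (a i) (b i)) (≡.sym (involutive (+ k))))) (swapped -[1+ k ]))
      where
      involutive : ∀ x → ℤ.- (1ℤ + (ℤ.- (1ℤ + x))) ≡ x
      involutive = solve-∀

      swapped : ∀ k → let r = ℤ.- (1ℤ + k) in term (e r) (a r) (b r) ≋ term (e′ k) (a′ k) (b′ k)
      swapped k rewrite e≡ k | a≡ k | b≡ k = term-comm (e′ k) (b′ k) (a′ k)

    W-negate : ∀ {e a b e′ a′ b′} →
      term (e (+ N)) (a (+ N)) (b (+ N)) ≋ 0̂ →
      term (e (ℤ.- (+ N))) (a (ℤ.- (+ N))) (b (ℤ.- (+ N))) ≋ 0̂ →
      (∀ k → e (ℤ.- k) ≡ e′ k) → (∀ k → a (ℤ.- k) ≡ b′ k) → (∀ k → b (ℤ.- k) ≡ a′ k) →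
      W e a b ≋ W e′ a′ b′
    W-negate {e} {a} {b} {e′} {a′} {b′} z⁺ z⁻ e≡ a≡ b≡ = trans (Σℤ-neg _ z⁺ z⁻)
      (Σℤ-cong (λ k → trans (term-comm (e (ℤ.- k)) (a (ℤ.- k)) (b (ℤ.- k)))
        (*-cong (reflexive (≡.cong pw (e≡ k)))
          (*-cong (reflexive (≡.cong u (b≡ k))) (reflexive (≡.cong u (a≡ k)))))))

    W-unfold : ∀ e a b → W e a b ≋ Σℤ (λ k → term (e k) (a k) (b k))
    W-unfold e a b = refl

  term-zeroˡ : ∀ e {a n} b → a ≡ -[1+ n ] → term e a b ≋ 0̂
  term-zeroˡ e b ≡.refl = trans (*-congˡ (zeroˡ _)) (zeroʳ _)

  term-zeroʳ : ∀ e a {b n} → b ≡ -[1+ n ] → term e a b ≋ 0̂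
  term-zeroʳ e a ≡.refl = trans (*-congˡ (zeroʳ _)) (zeroʳ _)

  -- If the inhomogeneous parts balance, x and y + t solve the same fixed-point equation. An
  -- identity X = Y + t thus follows from its Pascal descendants.
  solve-step : ∀ j {x y a a′ f f′ t t′} →
    x ≋ (a ⊕ f) ⊕ Q (suc j) ⊗ x → y ≋ (a′ ⊕ f′) ⊕ Q (suc j) ⊗ y → t ≋ t′ ⊕ Q (suc j) ⊗ t →
    a ⊕ f ≋ (a′ ⊕ f′) ⊕ t′ → x ≋ y ⊕ t
  solve-step j {x} {y} {a} {a′} {f} {f′} {t} {t′} x-eq y-eq t-eq eq = fixpoint-unique j
    (trans x-eq (+-congʳ eq))
    (begin
      y ⊕ t
        ≈⟨ +-cong y-eq t-eq ⟩
      ((a′ ⊕ f′) ⊕ p ⊗ y) ⊕ (t′ ⊕ p ⊗ t)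
        ≈⟨ solve 5 (λ a y t′ t p → (a :+ p :* y) :+ (t′ :+ p :* t) := (a :+ t′) :+ p :* (y :+ t)) refl _ _ _ _ _ ⟩
      ((a′ ⊕ f′) ⊕ t′) ⊕ p ⊗ (y ⊕ t) ∎)
    where p = Q (suc j)

  -- The finite q-binomial identities.

  -- In terms of q-binomial coefficients, X ≋ Y ⊕ t below reads
  --   even:  Σₖ q^{6k²+k}  [2ℓ; ℓ−3k]     − q^{6k²+5k+1} [2ℓ; ℓ−3k−1]   = 1,
  --   odd:   Σₖ q^{6k²+k}  [2ℓ−1; ℓ−3k−1] − q^{6k²+5k+1} [2ℓ−1; ℓ−3k−2] = 1,
  --   odd′:  Σₖ q^{6k²+4k} ([2ℓ+1; ℓ−3k] − [2ℓ+1; ℓ−3k−1])             = q^ℓ.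
  α β γ : ℤ → ℤ
  α = quadℤ 6 1 0
  β = quadℤ 6 5 1
  γ = quadℤ 6 4 0

  evenX evenY oddX oddY oddX′ oddY′ : ℤ → Carrier
  evenX ℓ = W α (λ k → ℓ - + 3 * k)       (λ k → ℓ + + 3 * k)
  evenY ℓ = W β (λ k → ℓ - + 3 * k - + 1) (λ k → ℓ + + 3 * k + + 1)
  oddX  ℓ = W α (λ k → ℓ - + 3 * k - + 1) (λ k → ℓ + + 3 * k)
  oddY  ℓ = W β (λ k → ℓ - + 3 * k - + 2) (λ k → ℓ + + 3 * k + + 1)
  oddX′ ℓ = W γ (λ k → ℓ - + 3 * k)       (λ k → ℓ + + 3 * k + + 1)
  oddY′ ℓ = W γ (λ k → ℓ - + 3 * k - + 1) (λ k → ℓ + + 3 * k + + 2)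

  α-nonneg : ∀ k → Nonneg (α k)
  α-nonneg = quadℤ-nonneg 1 5 0

  β-nonneg : ∀ k → Nonneg (β k)
  β-nonneg = quadℤ-nonneg 5 1 1

  γ-nonneg : ∀ k → Nonneg (γ k)
  γ-nonneg = quadℤ-nonneg 4 2 0

  -- The two indices add up to 0, so a nonzero product needs both to be 0. In `evenX` this happens
  -- only at k = 0; in `evenY` it would need 3k + 1 = 0.
  even-zero : evenX (+ 0) ≋ evenY (+ 0) ⊕ v 0
  even-zero = trans X≋v₀ (sym (trans (+-congʳ Y≋0) (+-identityˡ _)))
    where
    fX fY : ℤ → Carrier
    fX k = term (α k) (+ 0 - + 3 * k) (+ 0 + + 3 * k)
    fY k = term (β k) (+ 0 - + 3 * k - + 1) (+ 0 + + 3 * k + + 1)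

    eX⁺ : ∀ x → + 0 - + 3 * (1ℤ + x) ≡ ℤ.- (1ℤ + (x + x + x + + 2))
    eX⁺ = solve-∀
    eX⁻ : ∀ x → + 0 + + 3 * (ℤ.- (1ℤ + x)) ≡ ℤ.- (1ℤ + (x + x + x + + 2))
    eX⁻ = solve-∀
    eY⁺ : ∀ x → + 0 - + 3 * x - + 1 ≡ ℤ.- (1ℤ + (x + x + x))
    eY⁺ = solve-∀
    eY⁻ : ∀ x → + 0 + + 3 * (ℤ.- (1ℤ + x)) + + 1 ≡ ℤ.- (1ℤ + (x + x + x + + 1))
    eY⁻ = solve-∀

    X≋v₀ : evenX (+ 0) ≋ v 0
    X≋v₀ = begin
      evenX (+ 0)
        ≈⟨ W-unfold _ _ _ ⟩
      Σℤ fX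
        ≈⟨ Σℤ-unfold fX ⟩
      Σ< N (fX ∘ +_) ⊕ Σ< N (fX ∘ -[1+_])
        ≈⟨ +-cong (Σ<-suc M (fX ∘ +_)) (Σ<-zero N (λ k _ → term-zeroʳ (α -[1+ k ]) (+ 0 - + 3 * -[1+ k ]) (eX⁻ (+ k)))) ⟩
      (Q 0 ⊗ (v 0 ⊗ v 0) ⊕ Σ< M (λ k → fX (+ suc k))) ⊕ 0̂
        ≈⟨ trans (+-identityʳ _) (+-congˡ (Σ<-zero M (λ k _ → term-zeroˡ (α (+ suc k)) (+ 0 + + 3 * + suc k) (eX⁺ (+ k))))) ⟩
      Q 0 ⊗ (v 0 ⊗ v 0) ⊕ 0̂
        ≈⟨ trans (+-identityʳ _) (trans (*-cong Q-0 (*-congʳ v-0)) (trans (*-identityˡ _) (*-identityˡ _))) ⟩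
      v 0 ∎

    Y≋0 : evenY (+ 0) ≋ 0̂
    Y≋0 = begin
      evenY (+ 0)
        ≈⟨ W-unfold _ _ _ ⟩
      Σℤ fY
        ≈⟨ Σℤ-unfold fY ⟩
      Σ< N (fY ∘ +_) ⊕ Σ< N (fY ∘ -[1+_])
        ≈⟨ +-cong (Σ<-zero N (λ k _ → term-zeroˡ (β (+ k)) (+ 0 + + 3 * + k + + 1) (eY⁺ (+ k))))
                  (Σ<-zero N (λ k _ → term-zeroʳ (β -[1+ k ]) (+ 0 - + 3 * -[1+ k ] - + 1) (eY⁻ (+ k)))) ⟩
      0̂ ⊕ 0̂
        ≈⟨ +-identityʳ _ ⟩
      0̂ ∎

  -- The unweighted Pascal descendants are the even identity at L. The weighted ones, `F` and `G`,
  -- are exchanged by k ↦ -1-k and cancel.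
  odd-from-even : ∀ L → evenX (+ L) ≋ evenY (+ L) ⊕ v (L ℕ.+ L) →
                  oddX (+ suc L) ≋ oddY (+ suc L) ⊕ v (suc (L ℕ.+ L))
  odd-from-even L even = begin
    oddX ℓ
      -- The index ℓ + 3k is put first so that it is the one lowered without a weight.
      ≈⟨ W-swap (arg₁ x) (λ _ → ≡.refl) ⟩
    X
      ≈⟨ solve-step (L ℕ.+ L)
           (W-pascal α-nonneg aX bX (arg₂ x) (λ _ → ≡.refl) (λ _ → ≡.refl) (sum₁ x))
           (W-pascal β-nonneg aY bY (arg₃ x) (λ _ → ≡.refl) (λ _ → ≡.refl) (sum₂ x))
           (v-suc (L ℕ.+ L))
           (begin
             W α (λ k → x + + 3 * k) bX ⊕ F
               ≈⟨ +-cong (trans (W-swap (λ _ → ≡.refl) (λ _ → ≡.refl)) even)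
                         (W-reflect (flip₁ x) (flip₂ x) (flip₃ x)) ⟩
             (evenY x ⊕ v (L ℕ.+ L)) ⊕ G
               ≈⟨ solve 3 (λ y t f → (y :+ t) :+ f := (y :+ f) :+ t) refl _ _ _ ⟩
             (evenY x ⊕ G) ⊕ v (L ℕ.+ L)
               ≈⟨ +-congʳ (+-congʳ (W-swap (λ _ → ≡.refl) (λ _ → ≡.refl))) ⟩
             (W β (λ k → x + + 3 * k + + 1) bY ⊕ G) ⊕ v (L ℕ.+ L) ∎) ⟩
    Y ⊕ v (suc (L ℕ.+ L))
      ≈⟨ +-congʳ (W-swap (arg₄ x) (λ _ → ≡.refl)) ⟨
    oddY ℓ ⊕ v (suc (L ℕ.+ L)) ∎
    where
    x ℓ : ℤ
    x = + L
    ℓ = 1ℤ + x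
    aX bX aY bY : ℤ → ℤ
    aX k = ℓ + + 3 * k
    bX k = x - + 3 * k
    aY k = ℓ + + 3 * k + + 1
    bY k = x - + 3 * k - + 1
    X Y F G : Carrier
    X = W α aX bX
    Y = W β aY bY
    F = W (λ k → α k + aX k) aX (λ k → bX k - + 1)
    G = W (λ k → β k + aY k) aY (λ k → bY k - + 1)
    arg₁ : ∀ x k → 1ℤ + x - + 3 * k - + 1 ≡ x - + 3 * k
    arg₁ = solve-∀
    arg₂ : ∀ x k → 1ℤ + x + + 3 * k - + 1 ≡ x + + 3 * k
    arg₂ = solve-∀
    arg₃ : ∀ x k → 1ℤ + x + + 3 * k + + 1 - + 1 ≡ x + + 3 * k + + 1
    arg₃ = solve-∀
    arg₄ : ∀ x k → 1ℤ + x - + 3 * k - + 2 ≡ x - + 3 * k - + 1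
    arg₄ = solve-∀
    sum₁ : ∀ x k → (1ℤ + x + + 3 * k) + (x - + 3 * k) ≡ 1ℤ + (x + x)
    sum₁ = solve-∀
    sum₂ : ∀ x k → (1ℤ + x + + 3 * k + + 1) + (x - + 3 * k - + 1) ≡ 1ℤ + (x + x)
    sum₂ = solve-∀
    flip₁ : ∀ x k → + 6 * (ℤ.- (1ℤ + k) * ℤ.- (1ℤ + k)) + + 1 * ℤ.- (1ℤ + k) + + 0 + (1ℤ + x + + 3 * ℤ.- (1ℤ + k))
                      ≡ + 6 * (k * k) + + 5 * k + + 1 + (1ℤ + x + + 3 * k + + 1)
    flip₁ = solve-∀
    flip₂ : ∀ x k → 1ℤ + x + + 3 * ℤ.- (1ℤ + k) ≡ x - + 3 * k - + 1 - + 1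
    flip₂ = solve-∀
    flip₃ : ∀ x k → x - + 3 * ℤ.- (1ℤ + k) - + 1 ≡ 1ℤ + x + + 3 * k + + 1
    flip₃ = solve-∀

  -- Here the weighted descendants correspond under k ↦ -k: both carry the exponent ℓ + 6k² + 2k
  -- once k is negated in `F`. The bound on L serves this reflection.
  even-from-odd : ∀ L → suc L ℕ.≤ M → oddX (+ suc L) ≋ oddY (+ suc L) ⊕ v (suc (L ℕ.+ L)) →
                  evenX (+ suc L) ≋ evenY (+ suc L) ⊕ v (suc L ℕ.+ suc L)
  even-from-odd L L<M odd = solve-step (L ℕ.+ suc L)
    (W-pascal α-nonneg aX bX (λ _ → ≡.refl) (λ _ → ≡.refl) (λ _ → ≡.refl) (sum₁ ℓ))
    (W-pascal β-nonneg aY bY (arg₁ ℓ) (λ _ → ≡.refl) (arg₂ ℓ) (sum₂ ℓ))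
    (v-suc (L ℕ.+ suc L))
    (begin
      oddX ℓ ⊕ F
        ≈⟨ +-cong odd F≋G ⟩
      (oddY ℓ ⊕ v (suc (L ℕ.+ L))) ⊕ G
        ≈⟨ solve 3 (λ y t f → (y :+ t) :+ f := (y :+ f) :+ t) refl _ _ _ ⟩
      (oddY ℓ ⊕ G) ⊕ v (suc (L ℕ.+ L))
        ≡⟨ ≡.cong (λ n → (oddY ℓ ⊕ G) ⊕ v n) (≡.sym (ℕₚ.+-suc L L)) ⟩
      (oddY ℓ ⊕ G) ⊕ v (L ℕ.+ suc L) ∎)
    where
    ℓ : ℤ
    ℓ = + suc L
    aX bX aY bY : ℤ → ℤ
    aX k = ℓ - + 3 * k
    bX k = ℓ + + 3 * k
    aY k = ℓ - + 3 * k - + 1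
    bY k = ℓ + + 3 * k + + 1
    F G : Carrier
    F = W (λ k → α k + aX k) aX (λ k → bX k - + 1)
    G = W (λ k → β k + aY k) aY bX
    arg₁ : ∀ x k → x - + 3 * k - + 1 - + 1 ≡ x - + 3 * k - + 2
    arg₁ = solve-∀
    arg₂ : ∀ x k → x + + 3 * k + + 1 - + 1 ≡ x + + 3 * k
    arg₂ = solve-∀
    sum₁ : ∀ x k → (x - + 3 * k) + (x + + 3 * k) ≡ x + x
    sum₁ = solve-∀
    sum₂ : ∀ x k → (x - + 3 * k - + 1) + (x + + 3 * k + + 1) ≡ x + x
    sum₂ = solve-∀
    neg₁ : ∀ x k → + 6 * (ℤ.- k * ℤ.- k) + + 1 * ℤ.- k + + 0 + (x - + 3 * ℤ.- k)
                     ≡ + 6 * (k * k) + + 5 * k + + 1 + (x - + 3 * k - + 1)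
    neg₁ = solve-∀
    neg₂ : ∀ x k → x - + 3 * ℤ.- k ≡ x + + 3 * k
    neg₂ = solve-∀
    neg₃ : ∀ x k → x + + 3 * ℤ.- k - + 1 ≡ x - + 3 * k - + 1
    neg₃ = solve-∀
    below⁺ : ∀ x y → x - + 3 * (1ℤ + (x + y)) ≡ ℤ.- (1ℤ + (x + x + (y + y + y) + + 2))
    below⁺ = solve-∀
    below⁻ : ∀ x y → x + + 3 * ℤ.- (1ℤ + (x + y)) - + 1 ≡ ℤ.- (1ℤ + (x + x + (y + y + y) + + 3))
    below⁻ = solve-∀
    d : ℕ
    d = proj₁ (ℕₚ.m≤n⇒∃[o]m+o≡n L<M)
    N≡ : + N ≡ 1ℤ + (ℓ + + d)
    N≡ = ≡.cong (λ n → + suc n) (≡.sym (proj₂ (ℕₚ.m≤n⇒∃[o]m+o≡n L<M)))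
    F≋G : F ≋ G
    -- Since ℓ < N, the index ℓ - 3N is negative, so the terms at both ends of the window are 0.
    F≋G = W-negate
      (term-zeroˡ (α (+ N) + aX (+ N)) (bX (+ N) - + 1)
        (≡.trans (≡.cong aX N≡) (below⁺ ℓ (+ d))))
      (term-zeroʳ (α (ℤ.- (+ N)) + aX (ℤ.- (+ N))) (aX (ℤ.- (+ N)))
        (≡.trans (≡.cong (λ i → bX (ℤ.- i) - + 1) N≡) (below⁻ ℓ (+ d))))
      (neg₁ ℓ) (neg₂ ℓ) (neg₃ ℓ)

  even : ∀ L → L ℕ.≤ M → evenX (+ L) ≋ evenY (+ L) ⊕ v (L ℕ.+ L)
  even zero    _   = even-zero
  even (suc L) L<M = even-from-odd L L<M (odd-from-even L (even L (ℕₚ.<⇒≤ L<M)))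

  odd′ : ∀ L → L ℕ.≤ M → oddX′ (+ L) ≋ oddY′ (+ L) ⊕ Q L ⊗ v (suc (L ℕ.+ L))
  odd′ L L≤M = begin
    oddX′ ℓ
      ≈⟨ solve-step (L ℕ.+ L)
           (W-pascal γ-nonneg aX bX (λ _ → ≡.refl) (exponent ℓ) (arg₁ ℓ) (sum₁ ℓ))
           (W-pascal γ-nonneg aY bY (arg₂ ℓ) (λ _ → ≡.refl) (λ _ → ≡.refl) (sum₂ ℓ))
           (trans (*-congˡ (v-suc (L ℕ.+ L)))
             (solve 4 (λ a b p t → a :* (b :+ p :* t) := a :* b :+ p :* (a :* t)) refl _ _ _ _))
           (begin
             C ⊕ F
               ≈⟨ +-cong (W-swap (λ _ → ≡.refl) (λ _ → ≡.refl))
                    (trans (W-factor L α-nonneg aX evenb) (*-congˡ (even L L≤M))) ⟩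
             C′ ⊕ Q L ⊗ (evenY ℓ ⊕ v (L ℕ.+ L))
               ≈⟨ solve 4 (λ c q y t → c :+ q :* (y :+ t) := (c :+ q :* y) :+ q :* t) refl _ _ _ _ ⟩
             (C′ ⊕ Q L ⊗ evenY ℓ) ⊕ Q L ⊗ v (L ℕ.+ L)
               ≈⟨ +-congʳ (+-congˡ (trans (W-reflect (flip₁ ℓ) (flip₂ ℓ) (flip₃ ℓ))
                    (trans (W-swap (λ _ → ≡.refl) (λ _ → ≡.refl)) (W-factor L β-nonneg (λ k → ℓ - + 3 * k - + 1) bX)))) ⟨
             (C′ ⊕ G) ⊕ Q L ⊗ v (L ℕ.+ L) ∎) ⟩
    W γ aY bY ⊕ Q L ⊗ v (suc (L ℕ.+ L))
      ≈⟨ +-congʳ (W-swap (λ _ → ≡.refl) (λ _ → ≡.refl)) ⟨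
    oddY′ ℓ ⊕ Q L ⊗ v (suc (L ℕ.+ L)) ∎
    where
    ℓ : ℤ
    ℓ = + L
    aX bX aY bY evenb : ℤ → ℤ
    aX k = ℓ - + 3 * k
    bX k = ℓ + + 3 * k + + 1
    aY k = ℓ + + 3 * k + + 2
    bY k = ℓ - + 3 * k - + 1
    evenb k = ℓ + + 3 * k
    C C′ F G : Carrier
    C  = W γ (λ k → ℓ - + 3 * k - + 1) bX
    C′ = W γ bX bY
    F = W (λ k → ℓ + α k) aX evenb
    G = W (λ k → γ k + aY k) aY (λ k → bY k - + 1)
    exponent : ∀ x k → + 6 * (k * k) + + 4 * k + + 0 + (x - + 3 * k) ≡ x + (+ 6 * (k * k) + + 1 * k + + 0)
    exponent = solve-∀
    arg₁ : ∀ x k → x + + 3 * k + + 1 - + 1 ≡ x + + 3 * k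
    arg₁ = solve-∀
    arg₂ : ∀ x k → x + + 3 * k + + 2 - + 1 ≡ x + + 3 * k + + 1
    arg₂ = solve-∀
    sum₁ : ∀ x k → (x - + 3 * k) + (x + + 3 * k + + 1) ≡ 1ℤ + (x + x)
    sum₁ = solve-∀
    sum₂ : ∀ x k → (x + + 3 * k + + 2) + (x - + 3 * k - + 1) ≡ 1ℤ + (x + x)
    sum₂ = solve-∀
    flip₁ : ∀ x k → + 6 * (ℤ.- (1ℤ + k) * ℤ.- (1ℤ + k)) + + 4 * ℤ.- (1ℤ + k) + + 0 + (x + + 3 * ℤ.- (1ℤ + k) + + 2)
                      ≡ x + (+ 6 * (k * k) + + 5 * k + + 1)
    flip₁ = solve-∀
    flip₂ : ∀ x k → x + + 3 * ℤ.- (1ℤ + k) + + 2 ≡ x - + 3 * k - + 1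
    flip₂ = solve-∀
    flip₃ : ∀ x k → x - + 3 * ℤ.- (1ℤ + k) - + 1 - + 1 ≡ x + + 3 * k + + 1
    flip₃ = solve-∀

  -- Summation of the Bailey pair.

  Q-e₁-vanish : ∀ k → M ℕ.< ∣ k ∣ → pw (e₁ k) ≋ 0̂
  Q-e₁-vanish k M<k = trans (reflexive (≡.cong pw (≡.sym (e₁-nonneg k)))) (Q-vanish (ℕₚ.<-≤-trans M<k (∣k∣≤∣e₁∣ k)))

  r²+r-nonneg : ∀ r → Nonneg (r * r + r)
  r²+r-nonneg r = ≡.subst Nonneg (drop r) (quadℤ-nonneg 1 0 0 r)
    where
    drop : ∀ r → + 1 * (r * r) + + 1 * r + + 0 ≡ r * r + r
    drop = solve-∀

  rogers : Σ< N (λ n → Q (n ℕ.* n ℕ.+ n) ⊗ (Q n ⊗ v (suc (n ℕ.+ n)))) ⊕ v∞ ⊗ Σℤ (λ k → pw (e₂ k))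
             ≋ v∞ ⊗ Σℤ (λ k → pw (e₁ k))
  rogers = begin
    Σ< N (λ n → c n ⊗ (Q n ⊗ v (suc (n ℕ.+ n)))) ⊕ v∞ ⊗ Σℤ (λ k → pw (e₂ k))
      ≈⟨ +-congˡ oddY′-sum ⟨
    Σ< N (λ n → c n ⊗ (Q n ⊗ v (suc (n ℕ.+ n)))) ⊕ Σ< N (λ n → c n ⊗ oddY′ (+ n))
      ≈⟨ Σ<-+ N _ _ ⟨
    Σ< N (λ n → c n ⊗ (Q n ⊗ v (suc (n ℕ.+ n))) ⊕ c n ⊗ oddY′ (+ n))
      -- `odd′` is available only for n ≤ M, which is exactly the range of this sum.
      ≈⟨ Σ<-cong-< N (λ n n<N → trans (sym (distribˡ _ _ _))
           (*-congˡ (trans (+-comm _ _) (sym (odd′ n (ℕₚ.≤-pred n<N)))))) ⟩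
    Σ< N (λ n → c n ⊗ oddX′ (+ n))
      ≈⟨ oddX′-sum ⟩
    v∞ ⊗ Σℤ (λ k → pw (e₁ (ℤ.- k)))
      -- The choice r = 3k produces 15k² + 7k, the mirror image of the exponent in the theorem.
      ≈⟨ *-congˡ (Σℤ-neg (λ k → pw (e₁ k)) (Q-e₁-vanish (+ N) ℕₚ.≤-refl) (Q-e₁-vanish (ℤ.- (+ N)) ℕₚ.≤-refl)) ⟨
    v∞ ⊗ Σℤ (λ k → pw (e₁ k)) ∎
    where
    c : ℕ → Carrier
    c n = Q (n ℕ.* n ℕ.+ n)

    bailey : ∀ (r e : ℤ → ℤ) {A B : ℕ → ℤ → ℤ} →
      (∀ n k → A n k ≡ + n - r k) → (∀ n k → B n k ≡ + n + r k + + 1) →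
      (∀ k → γ k + (r k * r k + r k) ≡ e k) →
      Σ< N (λ n → c n ⊗ W γ (A n) (B n)) ≋ v∞ ⊗ Σℤ (λ k → pw (e k))
    bailey r e {A} {B} A≡ B≡ e≡ = begin
      Σ< N (λ n → c n ⊗ W γ (A n) (B n))
        ≈⟨ Σ<-cong N (λ n → *-congˡ (W-unfold γ (A n) (B n))) ⟩
      Σ< N (λ n → c n ⊗ Σℤ (λ k → pw (γ k) ⊗ (u (A n k) ⊗ u (B n k))))
        ≈⟨ Σ<-Σℤ-comm N c (λ k → pw (γ k)) (λ n k → u (A n k) ⊗ u (B n k)) ⟩
      Σℤ (λ k → pw (γ k) ⊗ Σ< N (λ n → c n ⊗ (u (A n k) ⊗ u (B n k))))
        ≈⟨ Σℤ-cong (λ k → *-congˡ (trans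
             (Σ<-cong N (λ n → *-congˡ (reflexive (≡.cong₂ (λ i j → u i ⊗ u j) (A≡ n k) (B≡ n k)))))
             (durfee-shifted (r k)))) ⟩
      Σℤ (λ k → pw (γ k) ⊗ (pw (r k * r k + r k) ⊗ v∞))
        ≈⟨ Σℤ-cong (λ k → trans (sym (*-assoc _ _ _)) (trans (*-comm _ _) (*-congˡ
             (trans (sym (pw-+ (γ-nonneg k) (r²+r-nonneg (r k)))) (reflexive (≡.cong pw (e≡ k))))))) ⟩
      Σℤ (λ k → v∞ ⊗ pw (e k))
        ≈⟨ Σℤ-* v∞ (λ k → pw (e k)) ⟩
      v∞ ⊗ Σℤ (λ k → pw (e k)) ∎

    exponent₁ : ∀ k → + 6 * (k * k) + + 4 * k + + 0 + (+ 3 * k * (+ 3 * k) + + 3 * k)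
                        ≡ + 15 * (ℤ.- k * (ℤ.- k * 1ℤ)) - + 7 * (ℤ.- k)
    exponent₁ = solve-∀
    exponent₂ : ∀ k → + 6 * (k * k) + + 4 * k + + 0 + ((+ 3 * k + + 1) * (+ 3 * k + + 1) + (+ 3 * k + + 1))
                        ≡ + 15 * (k * (k * 1ℤ)) + + 13 * k + + 2
    exponent₂ = solve-∀
    arg₁ : ∀ x k → x - + 3 * k - + 1 ≡ x - (+ 3 * k + + 1)
    arg₁ = solve-∀
    arg₂ : ∀ x k → x + + 3 * k + + 2 ≡ x + (+ 3 * k + + 1) + + 1
    arg₂ = solve-∀

    oddX′-sum : Σ< N (λ n → c n ⊗ oddX′ (+ n)) ≋ v∞ ⊗ Σℤ (λ k → pw (e₁ (ℤ.- k)))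
    oddX′-sum = bailey (λ k → + 3 * k) (λ k → e₁ (ℤ.- k)) (λ _ _ → ≡.refl) (λ _ _ → ≡.refl) exponent₁

    oddY′-sum : Σ< N (λ n → c n ⊗ oddY′ (+ n)) ≋ v∞ ⊗ Σℤ (λ k → pw (e₂ k))
    oddY′-sum = bailey (λ k → + 3 * k + + 1) e₂ (λ n → arg₁ (+ n)) (λ n → arg₂ (+ n)) exponent₂

-- The ring of truncated power series.

infixl 6 _⊞_

_⊞_ : Series → Series → Series
(f ⊞ g) n = f n + g n

⊛-cong-≤ : ∀ n {f f′ g g′} → (∀ m → m ℕ.≤ n → f m ≡ f′ m) → (∀ m → m ℕ.≤ n → g m ≡ g′ m) →
           (f ⊛ g) n ≡ (f′ ⊛ g′) n
⊛-cong-≤ zero    p r = ≡.cong (_+ + 0) (≡.cong₂ _*_ (p 0 z≤n) (r 0 z≤n))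
⊛-cong-≤ (suc n) p r = ≡.cong₂ _+_
  (≡.cong₂ _*_ (p 0 z≤n) (r (suc n) ℕₚ.≤-refl))
  (⊛-cong-≤ n (λ m m≤n → p (suc m) (s≤s m≤n)) (λ m m≤n → r m (ℕₚ.m≤n⇒m≤1+n m≤n)))

⊛-zeroˡ : ∀ g → (λ _ → + 0) ⊛ g ≈ (λ _ → + 0)
⊛-zeroˡ g zero    = ≡.refl
⊛-zeroˡ g (suc n) = ≡.trans (ℤₚ.+-identityˡ _) (⊛-zeroˡ g n)

⊛-identityˡ : ∀ g → 𝟙 ⊛ g ≈ g
⊛-identityˡ g zero    = ≡.trans (ℤₚ.+-identityʳ _) (ℤₚ.*-identityˡ _)
⊛-identityˡ g (suc n) = ≡.trans (≡.cong₂ _+_ (ℤₚ.*-identityˡ (g (suc n))) (⊛-zeroˡ g n)) (ℤₚ.+-identityʳ _)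

⊛-scaleˡ : ∀ c f g → (λ n → c * f n) ⊛ g ≈ (λ n → c * (f ⊛ g) n)
⊛-scaleˡ c f g zero    = solve-zero c (f 0) (g 0)
  where
  solve-zero : ∀ c x y → c * x * y + + 0 ≡ c * (x * y + + 0)
  solve-zero = solve-∀
⊛-scaleˡ c f g (suc n) = ≡.trans (≡.cong (_+_ (c * f 0 * g (suc n))) (⊛-scaleˡ c (f ∘ suc) g n))
  (factor c (f 0) (g (suc n)) (((f ∘ suc) ⊛ g) n))
  where
  factor : ∀ c x y z → c * x * y + c * z ≡ c * (x * y + z)
  factor = solve-∀

⊛-distribʳ : ∀ h f g → (f ⊞ g) ⊛ h ≈ (f ⊛ h) ⊞ (g ⊛ h)
⊛-distribʳ h f g zero    = distrib (f 0) (g 0) (h 0)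
  where
  distrib : ∀ x y z → (x + y) * z + + 0 ≡ (x * z + + 0) + (y * z + + 0)
  distrib = solve-∀
⊛-distribʳ h f g (suc n) = ≡.trans
  (≡.cong (_+_ ((f 0 + g 0) * h (suc n))) (⊛-distribʳ h (f ∘ suc) (g ∘ suc) n))
  (distrib (f 0) (g 0) (h (suc n)) (((f ∘ suc) ⊛ h) n) (((g ∘ suc) ⊛ h) n))
  where
  distrib : ∀ x y z s t → (x + y) * z + (s + t) ≡ (x * z + s) + (y * z + t)
  distrib = solve-∀

-- The product recurses on its left factor; this mirror recursion on the right factor is what
-- commutativity needs.
⊛-last : ∀ f g n → (f ⊛ g) (suc n) ≡ f (suc n) * g 0 + (f ⊛ (g ∘ suc)) n
⊛-last f g zero    = swap (f 0 * g 1) (f 1 * g 0)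
  where
  swap : ∀ x y → x + (y + + 0) ≡ y + (x + + 0)
  swap = solve-∀
⊛-last f g (suc n) = ≡.trans (≡.cong (_+_ (f 0 * g (suc (suc n)))) (⊛-last (f ∘ suc) g n))
  (swap (f 0 * g (suc (suc n))) (f (suc (suc n)) * g 0) (((f ∘ suc) ⊛ (g ∘ suc)) n))
  where
  swap : ∀ x y z → x + (y + z) ≡ y + (x + z)
  swap = solve-∀

⊛-comm : ∀ f g → f ⊛ g ≈ g ⊛ f
⊛-comm f g zero    = ≡.cong (_+ + 0) (ℤₚ.*-comm (f 0) (g 0))
⊛-comm f g (suc n) = ≡.trans (≡.cong₂ _+_ (ℤₚ.*-comm (f 0) (g (suc n))) (⊛-comm (f ∘ suc) g n)) (≡.sym (⊛-last g f n))

⊛-assoc : ∀ f g h → (f ⊛ g) ⊛ h ≈ f ⊛ (g ⊛ h)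
⊛-assoc f g h zero    = assoc (f 0) (g 0) (h 0)
  where
  assoc : ∀ x y z → (x * y + + 0) * z + + 0 ≡ x * (y * z + + 0) + + 0
  assoc = solve-∀
⊛-assoc f g h (suc n) = begin
  -- By definition, the tail of f ⊛ g is f₀ g⁺ + f⁺ ⊛ g.
  head + (((λ m → f 0 * g (suc m)) ⊞ (f⁺ ⊛ g)) ⊛ h) n
    ≡⟨ ≡.cong (_+_ head) (⊛-distribʳ h (λ m → f 0 * g (suc m)) (f⁺ ⊛ g) n) ⟩
  head + (((λ m → f 0 * g (suc m)) ⊛ h) n + ((f⁺ ⊛ g) ⊛ h) n)
    ≡⟨ ≡.cong (_+_ head) (≡.cong₂ _+_ (⊛-scaleˡ (f 0) g⁺ h n) (⊛-assoc f⁺ g h n)) ⟩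
  head + (f 0 * (g⁺ ⊛ h) n + (f⁺ ⊛ (g ⊛ h)) n)
    ≡⟨ regroup (f 0) (g 0) (h (suc n)) ((g⁺ ⊛ h) n) ((f⁺ ⊛ (g ⊛ h)) n) ⟩
  f 0 * (g 0 * h (suc n) + (g⁺ ⊛ h) n) + (f⁺ ⊛ (g ⊛ h)) n ∎
  where
  open ≡.≡-Reasoning
  f⁺ g⁺ : Series
  f⁺ = f ∘ suc
  g⁺ = g ∘ suc
  head : ℤ
  head = (f 0 * g 0 + + 0) * h (suc n)
  regroup : ∀ x y z s t → (x * y + + 0) * z + (x * s + t) ≡ x * (y * z + s) + t
  regroup = solve-∀

q^-+ : ∀ m n → q^ (m ℕ.+ n) ≈ q^ m ⊛ q^ n
q^-+ zero    n k       = ≡.sym (⊛-identityˡ (q^ n) k)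
q^-+ (suc m) n zero    = ≡.refl
q^-+ (suc m) n (suc k) = ≡.trans (q^-+ m n k) (≡.sym (ℤₚ.+-identityˡ _))

-- ℤ[[q]]/(q^{M+1}): agreement of the coefficients up to q^M.
truncatedSeries : ℕ → CommutativeRing 0ℓ 0ℓ
truncatedSeries M = record
  { Carrier           = Series
  ; _≈_               = λ f g → ∀ m → m ℕ.≤ M → f m ≡ g m
  ; _+_               = _⊞_
  ; _*_               = _⊛_
  ; -_                = λ f n → ℤ.- f n
  ; 0#                = λ _ → + 0
  ; 1#                = 𝟙
  ; isCommutativeRing = record
    { isRing = record
      { +-isAbelianGroup = record
        { isGroup = record
          { isMonoid = record
            { isSemigroup = record
              { isMagma = record
                { isEquivalence = record
                  { refl  = λ _ _ → ≡.refl
                  ; sym   = λ p m m≤M → ≡.sym (p m m≤M)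
                  ; trans = λ p r m m≤M → ≡.trans (p m m≤M) (r m m≤M)
                  }
                ; ∙-cong = λ p r m m≤M → ≡.cong₂ _+_ (p m m≤M) (r m m≤M)
                }
              ; assoc = λ f g h m _ → ℤₚ.+-assoc (f m) (g m) (h m)
              }
            ; identity = (λ f m _ → ℤₚ.+-identityˡ (f m)) , (λ f m _ → ℤₚ.+-identityʳ (f m))
            }
          ; inverse = (λ f m _ → ℤₚ.+-inverseˡ (f m)) , (λ f m _ → ℤₚ.+-inverseʳ (f m))
          ; ⁻¹-cong = λ p m m≤M → ≡.cong ℤ.-_ (p m m≤M)
          }
        ; comm = λ f g m _ → ℤₚ.+-comm (f m) (g m)
        }
      ; *-cong = λ p r m m≤M → ⊛-cong-≤ m
          (λ i i≤m → p i (ℕₚ.≤-trans i≤m m≤M)) (λ i i≤m → r i (ℕₚ.≤-trans i≤m m≤M))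
      ; *-assoc = λ f g h m _ → ⊛-assoc f g h m
      ; *-identity = (λ f m _ → ⊛-identityˡ f m)
                   , (λ f m _ → ≡.trans (⊛-comm f 𝟙 m) (⊛-identityˡ f m))
      ; distrib = (λ f g h m _ → ≡.trans (⊛-comm f (g ⊞ h) m)
                    (≡.trans (⊛-distribʳ f g h m) (≡.cong₂ _+_ (⊛-comm g f m) (⊛-comm h f m))))
                , (λ f g h m _ → ⊛-distribʳ f g h m)
      }
    ; *-comm = λ f g m _ → ⊛-comm f g m
    }
  }

-- The usual x = x(gy) = (xf)y = y. Agreement of f and g up to q^M suffices, which later identifies
-- 1/(q;q)_N with 1/(q;q)_∞ in the quotient.
inverse-unique : ∀ M → let open CommutativeRing (truncatedSeries M) renaming (_≈_ to _≋_) in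
  ∀ {f g x y} → f ≋ g → x ⊛ f ≋ 𝟙 → y ⊛ g ≋ 𝟙 → x ≋ y
inverse-unique M {f} {g} {x} {y} f≋g xf≋1 yg≋1 = begin
  x              ≈⟨ *-identityʳ x ⟨
  x ⊛ 𝟙          ≈⟨ *-congˡ {x} yg≋1 ⟨
  x ⊛ (y ⊛ g)    ≈⟨ *-congˡ {x} (*-comm y g) ⟩
  x ⊛ (g ⊛ y)    ≈⟨ *-assoc x g y ⟨
  (x ⊛ g) ⊛ y    ≈⟨ *-congʳ {y} (*-congˡ {x} f≋g) ⟨
  (x ⊛ f) ⊛ y    ≈⟨ *-congʳ {y} xf≋1 ⟩
  𝟙 ⊛ y          ≈⟨ *-identityˡ y ⟩
  y              ∎
  where
  open CommutativeRing (truncatedSeries M) hiding (_-_; _+_; _*_)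
  open ≋-Reasoning setoid

seriesQRing : ℕ → QRing
seriesQRing M = record
  { commutativeRing = truncatedSeries M
  ; M     = M
  ; Q     = q^_
  ; v     = λ n → inv (qPoch n)
  ; Q-0   = λ _ _ → ≡.refl
  ; Q-+   = λ m n k _ → q^-+ m n k
  ; Q-vanish = λ M<n m m≤M → q^-below (ℕₚ.≤-<-trans m≤M M<n)
  ; v-0   = inverse-unique M {𝟙} {𝟙} {inv 𝟙} {𝟙} (λ _ _ → ≡.refl)
              (λ m _ → inv-inverse 𝟙 ≡.refl m) (λ m _ → ⊛-identityˡ 𝟙 m)
  ; v-suc = v-suc
  }
  where
  open CommutativeRing (truncatedSeries M) hiding (_-_; _+_; _*_) renaming (_≈_ to _≋_)
  open ≋-Reasoning setoid

  v : ℕ → Series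
  v n = inv (qPoch n)

  v-pred : ∀ n → v n ≋ (𝟙 ⊖ q^ (suc n)) ⊛ v (suc n)
  v-pred n = inverse-unique M {qPoch n} {qPoch n} {v n} {d ⊛ v (suc n)} (λ _ _ → ≡.refl)
    (λ m _ → inv-inverse (qPoch n) (qPoch-0 n) m)
    (begin
      (d ⊛ v (suc n)) ⊛ qPoch n    ≈⟨ *-congʳ {qPoch n} (*-comm d (v (suc n))) ⟩
      (v (suc n) ⊛ d) ⊛ qPoch n    ≈⟨ *-assoc (v (suc n)) d (qPoch n) ⟩
      v (suc n) ⊛ (d ⊛ qPoch n)    ≈⟨ *-congˡ {v (suc n)} (*-comm d (qPoch n)) ⟩
      v (suc n) ⊛ qPoch (suc n)    ≈⟨ (λ m _ → inv-inverse (qPoch (suc n)) (qPoch-0 (suc n)) m) ⟩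
      𝟙                            ∎)
    where
    d : Series
    d = 𝟙 ⊖ q^ (suc n)

  v-suc : ∀ n → v (suc n) ≋ v n ⊞ (q^ (suc n) ⊛ v (suc n))
  v-suc n = begin
    v′                               ≈⟨ *-identityˡ v′ ⟨
    𝟙 ⊛ v′                           ≈⟨ *-congʳ {v′} (λ m _ → cancel (𝟙 m) (x m)) ⟩
    ((𝟙 ⊖ x) ⊞ x) ⊛ v′               ≈⟨ distribʳ v′ (𝟙 ⊖ x) x ⟩
    ((𝟙 ⊖ x) ⊛ v′) ⊞ (x ⊛ v′)        ≈⟨ +-congʳ {x ⊛ v′} (v-pred n) ⟨
    v n ⊞ (x ⊛ v′)                   ∎
    where
    v′ x : Series
    v′ = v (suc n)
    x = q^ (suc n)
    cancel : ∀ a b → a ≡ a - b + b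
    cancel = solve-∀

-- From truncated sums back to formal sums.

listSum : List ℤ → ℤ
listSum = foldr _+_ (+ 0)

listSum-++ : ∀ xs ys → listSum (xs ++ ys) ≡ listSum xs + listSum ys
listSum-++ []       ys = ≡.sym (ℤₚ.+-identityˡ _)
listSum-++ (x ∷ xs) ys = ≡.trans (≡.cong (_+_ x) (listSum-++ xs ys)) (≡.sym (ℤₚ.+-assoc x _ _))

listSum-extend : ∀ m n f → (∀ i → m ℕ.≤ i → f i ≡ + 0) →
                 listSum (applyUpTo f (m ℕ.+ n)) ≡ listSum (applyUpTo f m)
listSum-extend zero    zero    f z = ≡.refl
listSum-extend zero    (suc n) f z = ≡.cong₂ _+_ (z 0 z≤n) (listSum-extend zero n (f ∘ suc) (λ i _ → z (suc i) z≤n))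
listSum-extend (suc m) n       f z = ≡.cong (_+_ (f 0)) (listSum-extend m n (f ∘ suc) (λ i m≤i → z (suc i) (s≤s m≤i)))

map-map-upTo : ∀ {A B : Set} (g : A → B) (f : ℕ → A) n → map g (map f (upTo n)) ≡ applyUpTo (g ∘ f) n
map-map-upTo g f n = ≡.trans (≡.cong (map g) (map-upTo f n)) (map-applyUpTo f g n)

module _ (M : ℕ) where
  open InQRing (seriesQRing M)
  open CommutativeRing (truncatedSeries M) hiding (_-_; _+_; _*_) renaming (_≈_ to _≋_)
  open import Algebra.Properties.Group +-group using () renaming (∙-cancelʳ to ⊞-cancelʳ)

  Σ<-coefficient : ∀ n F m → m ℕ.≤ M → Σ< n F m ≡ listSum (applyUpTo (λ i → F i m) n)
  Σ<-coefficient zero    F m m≤M = Σ<-empty F m m≤M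
  Σ<-coefficient (suc n) F m m≤M = ≡.trans (Σ<-suc n F m m≤M) (≡.cong (_+_ (F 0 m)) (Σ<-coefficient n (F ∘ suc) m m≤M))

  lhs-coefficient : Sum lhsTerm lhs-summable M ≡ Σ< N lhsTerm M
  lhs-coefficient = ≡.trans
    (≡.cong listSum (map-upTo (λ n → lhsTerm n M) N))
    (≡.sym (Σ<-coefficient N lhsTerm M ℕₚ.≤-refl))

  -- The support used by `Sum` depends on the coefficient m, whereas the window depends on M. The
  -- additional terms vanish because both exponents are at least |k| > m.
  rhs-truncated : Sum rhsTerm rhs-summable ≋ Σℤ rhsTerm
  rhs-truncated m m≤M = begin
    listSum (map (λ k → rhsTerm k m) (map (λ i → + i) (upTo (suc m)) ++ map -[1+_] (upTo (suc m))))
      ≡⟨ ≡.cong listSum (map-++ (λ k → rhsTerm k m) (map (λ i → + i) (upTo (suc m))) _) ⟩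
    _
      ≡⟨ listSum-++ (map (λ k → rhsTerm k m) (map (λ i → + i) (upTo (suc m)))) _ ⟩
    _
      ≡⟨ ≡.cong₂ _+_ (half (λ i → + i) (λ _ → ℕₚ.≤-refl)) (half -[1+_] ℕₚ.n≤1+n) ⟩
    (Σ< N (rhsTerm ∘ +_) ⊞ Σ< N (rhsTerm ∘ -[1+_])) m
      ≡⟨ Σℤ-unfold rhsTerm m m≤M ⟨
    Σℤ rhsTerm m ∎
    where
    open ≡.≡-Reasoning
    half : (ι : ℕ → ℤ) → (∀ i → i ℕ.≤ ∣ ι i ∣) →
      listSum (map (λ k → rhsTerm k m) (map ι (upTo (suc m)))) ≡ Σ< N (rhsTerm ∘ ι) m
    half ι i≤ι = begin
      listSum (map (λ k → rhsTerm k m) (map ι (upTo (suc m))))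
        ≡⟨ ≡.cong listSum (map-map-upTo (λ k → rhsTerm k m) ι (suc m)) ⟩
      listSum (applyUpTo (λ i → rhsTerm (ι i) m) (suc m))
        ≡⟨ listSum-extend (suc m) (M ℕ.∸ m) (λ i → rhsTerm (ι i) m) beyond ⟨
      listSum (applyUpTo (λ i → rhsTerm (ι i) m) (suc m ℕ.+ (M ℕ.∸ m)))
        ≡⟨ ≡.cong (λ n → listSum (applyUpTo (λ i → rhsTerm (ι i) m) (suc n))) (ℕₚ.m+[n∸m]≡n m≤M) ⟩
      listSum (applyUpTo (λ i → rhsTerm (ι i) m) N)
        ≡⟨ Σ<-coefficient N (rhsTerm ∘ ι) m m≤M ⟨
      Σ< N (rhsTerm ∘ ι) m ∎
      where
      beyond : ∀ i → suc m ℕ.≤ i → rhsTerm (ι i) m ≡ + 0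
      beyond i m<i = ≡.cong₂ _-_
        (q^-below (ℕₚ.<-≤-trans m<i (ℕₚ.≤-trans (i≤ι i) (∣k∣≤∣e₁∣ (ι i)))))
        (q^-below (ℕₚ.<-≤-trans m<i (ℕₚ.≤-trans (i≤ι i) (∣k∣≤∣e₂∣ (ι i)))))

  v∞≋inv-qPoch∞ : v∞ ≋ inv qPoch∞
  v∞≋inv-qPoch∞ = inverse-unique M {qPoch N} {qPoch∞} {v∞} {inv qPoch∞}
    (λ m m≤M → Convergent.stable qPoch-convergent m N (ℕₚ.m≤n⇒m≤1+n m≤M))
    (λ m _ → inv-inverse (qPoch N) (qPoch-0 N) m)
    (λ m _ → inv-inverse qPoch∞ ≡.refl m)

  Σℤ-rhsTerm : Σℤ rhsTerm ⊞ Σℤ (λ k → pw (e₂ k)) ≋ Σℤ (λ k → pw (e₁ k))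
  Σℤ-rhsTerm = begin
    Σℤ rhsTerm ⊞ Σℤ (λ k → pw (e₂ k))
      ≈⟨ Σℤ-+ rhsTerm (λ k → pw (e₂ k)) ⟨
    Σℤ (λ k → rhsTerm k ⊞ pw (e₂ k))
      ≈⟨ Σℤ-cong {λ k → rhsTerm k ⊞ pw (e₂ k)} {λ k → pw (e₁ k)} difference ⟩
    Σℤ (λ k → pw (e₁ k)) ∎
    where
    open ≋-Reasoning setoid
    cancel : ∀ a b → a - b + b ≡ a
    cancel = solve-∀
    difference : ∀ k m → m ℕ.≤ M → (rhsTerm k ⊞ pw (e₂ k)) m ≡ pw (e₁ k) m
    difference k m _ = ≡.subst₂ (λ i j → (rhsTerm k ⊞ pw j) m ≡ pw i m) (e₁-nonneg k) (e₂-nonneg k)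
      (cancel ((q^ ∣ e₁ k ∣) m) ((q^ ∣ e₂ k ∣) m))

  lhsTerm-split : ∀ n → lhsTerm n ≋ q^ (n ℕ.* n ℕ.+ n) ⊛ (q^ n ⊛ inv (qPoch (suc (n ℕ.+ n))))
  lhsTerm-split n = begin
    q^ (n ℕ.^ 2 ℕ.+ 2 ℕ.* n) ⊛ inv (qPoch (2 ℕ.* n ℕ.+ 1))
      ≡⟨ ≡.cong₂ (λ i j → q^ i ⊛ inv (qPoch j)) (exponent n) (index n) ⟩
    q^ (n ℕ.* n ℕ.+ n ℕ.+ n) ⊛ x
      ≈⟨ *-congʳ {x} (λ m _ → q^-+ (n ℕ.* n ℕ.+ n) n m) ⟩
    (q^ (n ℕ.* n ℕ.+ n) ⊛ q^ n) ⊛ x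
      ≈⟨ *-assoc (q^ (n ℕ.* n ℕ.+ n)) (q^ n) x ⟩
    q^ (n ℕ.* n ℕ.+ n) ⊛ (q^ n ⊛ x) ∎
    where
    open ≋-Reasoning setoid
    x : Series
    x = inv (qPoch (suc (n ℕ.+ n)))
    exponent : ∀ n → n ℕ.* (n ℕ.* 1) ℕ.+ 2 ℕ.* n ≡ n ℕ.* n ℕ.+ n ℕ.+ n
    exponent = ℕ-Solver.solve-∀
    index : ∀ n → 2 ℕ.* n ℕ.+ 1 ≡ suc (n ℕ.+ n)
    index = ℕ-Solver.solve-∀

  -- The subtraction enters here: `rogers` has v∞ `E₂` added on the left, and splitting `E₁` as the
  -- theta series plus `E₂` lets that summand cancel.
  truncated-identity : Σ< N lhsTerm ≋ inv qPoch∞ ⊛ Sum rhsTerm rhs-summable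
  truncated-identity = ⊞-cancelʳ (v∞ ⊛ E₂) (Σ< N lhsTerm) (inv qPoch∞ ⊛ rhs) (begin
    Σ< N lhsTerm ⊞ (v∞ ⊛ E₂)
      ≈⟨ +-congʳ {v∞ ⊛ E₂} (Σ<-cong N {lhsTerm} {λ n → q^ (n ℕ.* n ℕ.+ n) ⊛ (q^ n ⊛ inv (qPoch (suc (n ℕ.+ n))))} lhsTerm-split) ⟩
    _
      ≈⟨ rogers ⟩
    v∞ ⊛ E₁
      ≈⟨ *-congˡ {v∞} Σℤ-rhsTerm ⟨
    v∞ ⊛ (Σℤ rhsTerm ⊞ E₂)
      ≈⟨ distribˡ v∞ (Σℤ rhsTerm) E₂ ⟩
    (v∞ ⊛ Σℤ rhsTerm) ⊞ (v∞ ⊛ E₂)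
      ≈⟨ +-congʳ {v∞ ⊛ E₂} (*-cong {v∞} {inv qPoch∞} {Σℤ rhsTerm} {rhs}
           v∞≋inv-qPoch∞ (sym {rhs} {Σℤ rhsTerm} rhs-truncated)) ⟩
    (inv qPoch∞ ⊛ rhs) ⊞ (v∞ ⊛ E₂) ∎)
    where
    open ≋-Reasoning setoid
    E₁ E₂ rhs : Series
    rhs = Sum rhsTerm rhs-summable
    E₁ = Σℤ (λ k → pw (e₁ k))
    E₂ = Σℤ (λ k → pw (e₂ k))

corollary5p4 : Sum (λ (n : ℕ) → q^ (n ℕ.^ 2 ℕ.+ 2 ℕ.* n) ⊛ inv (qPoch (2 ℕ.* n ℕ.+ 1))) lhs-summable
    ≈ inv qPoch∞ ⊛ Sum (λ (k : ℤ) → q^ ∣ + 15 * k ^ 2 - + 7 * k ∣ ⊖ q^ ∣ + 15 * k ^ 2 + + 13 * k + + 2 ∣) rhs-summable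
-- The coefficient of q^m is read off in the truncation with M = m.
corollary5p4 m = ≡.trans (lhs-coefficient m) (truncated-identity m m ℕₚ.≤-refl)
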